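{- The Petersen graph is the unique connected graph on $10$ vertices with cop number $3$; every other connected graph on $10$ vertices has cop number at most $2$.
   Context: Game of cops and robbers on a connected graph $G$: first $k$ cops are placed on vertices (several cops may share a vertex), then the robber is placed on a vertex; then cops and robber alternate moves, the cops moving first. On the cops' turn each cop moves to a neighboring vertex or stays put; on the robber's turn he does likewise. All positions are always known to all players. The cops win if at some finite time a cop occupies the same vertex as the robber. The cop number $c(G)$ is the minimum $k$ such that $k$ cops have a strategy that wins against every robber strategy. The Petersen graph is the 3-regular graph on 10 vertices of girth 5 (e.g. the Kneser graph $KG(5,2)$). -}

module Defs where

open import Data.Nat using (ℕ; zero; suc; _≤_)
open import Data.Fin using (Fin; #_; _≟_)
open import Data.Bool using (Bool; true; false; not; _∨_)
open import Data.Product using (Σ; ∃; _×_; _,_; proj₁; proj₂)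
open import Data.Sum using (_⊎_)
open import Data.Vec using (Vec; []; _∷_; head; lookup)
open import Relation.Nullary using (¬_; yes; no)
open import Relation.Nullary.Decidable using (⌊_⌋)
open import Relation.Binary.PropositionalEquality using (_≡_; refl; sym)
open import Function.Bundles using (_↔_; Inverse)

record Graph (n : ℕ) : Set where
  field
    adj    : Fin n → Fin n → Bool
    adj-sym    : ∀ u v → adj u v ≡ adj v u
    adj-irrefl : ∀ v → adj v v ≡ false

open Graph public

Edge : ∀ {n} → Graph n → Fin n → Fin n → Set
Edge G u v = adj G u v ≡ true

data Reach {n} (G : Graph n) (u : Fin n) : Fin n → Set where
  here : Reach G u u
  step : ∀ {v w} → Reach G u v → Edge G v w → Reach G u w

Connected : ∀ {n} → Graph n → Set
Connected G = ∀ u v → Reach G u v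

_≅_ : ∀ {n} → Graph n → Graph n → Set
_≅_ {n} G H = Σ (Fin n ↔ Fin n) λ f →
  ∀ u v → adj G u v ≡ adj H (Inverse.to f u) (Inverse.to f v)

-- The Petersen graph as the Kneser graph KG(5,2):
-- vertices are the 2-subsets of {0,..,4}, adjacent iff disjoint.

eqb : ∀ {m} → Fin m → Fin m → Bool
eqb a b = ⌊ a ≟ b ⌋

eqb-sym : ∀ {m} (a b : Fin m) → eqb a b ≡ eqb b a
eqb-sym a b with a ≟ b | b ≟ a
... | yes _ | yes _ = refl
... | no _  | no _  = refl
... | yes p | no q  with q (sym p)
... | ()
eqb-sym a b | no q | yes p with q (sym p)
... | ()

eqb-refl : ∀ {m} (a : Fin m) → eqb a a ≡ true
eqb-refl a with a ≟ a
... | yes _ = refl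
... | no q with q refl
... | ()

pairs : Vec (Fin 5 × Fin 5) 10
pairs = (# 0 , # 1) ∷ (# 0 , # 2) ∷ (# 0 , # 3) ∷ (# 0 , # 4) ∷ (# 1 , # 2)
      ∷ (# 1 , # 3) ∷ (# 1 , # 4) ∷ (# 2 , # 3) ∷ (# 2 , # 4) ∷ (# 3 , # 4) ∷ []

disj : Fin 5 × Fin 5 → Fin 5 × Fin 5 → Bool
disj (a , b) (c , d) = not (eqb a c ∨ eqb a d ∨ eqb b c ∨ eqb b d)

disj-sym : ∀ p q → disj p q ≡ disj q p
disj-sym (a , b) (c , d)
  rewrite eqb-sym c a | eqb-sym c b | eqb-sym d a | eqb-sym d b
  with eqb a c | eqb a d | eqb b c | eqb b d
... | true  | _     | _     | _     = refl
... | false | true  | true  | _     = refl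
... | false | true  | false | _     = refl
... | false | false | true  | _     = refl
... | false | false | false | true  = refl
... | false | false | false | false = refl

disj-irrefl : ∀ p → disj p p ≡ false
disj-irrefl (a , b) rewrite eqb-refl a = refl

Petersen : Graph 10
Petersen = record
  { adj        = λ u v → disj (lookup pairs u) (lookup pairs v)
  ; adj-sym    = λ u v → disj-sym (lookup pairs u) (lookup pairs v)
  ; adj-irrefl = λ v → disj-irrefl (lookup pairs v)
  }

module _ {n : ℕ} (G : Graph n) (k : ℕ) where

  Move : Fin n → Fin n → Set
  Move u v = u ≡ v ⊎ Edge G u v

  Config : Set
  Config = Fin k → Fin n

  -- Histories are vectors with the most recent position at the head.
  -- After round i the history has i+1 cop configurations and i+1 robber positions.
  record CopStrategy : Set where
    field
      place : Config
      move  : ∀ i (cs : Vec Config (suc i)) (rs : Vec (Fin n) (suc i)) →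
              Σ Config λ c' → ∀ j → Move (head cs j) (c' j)

  -- the robber sees the cops' (new) positions before choosing
  record RobberStrategy : Set where
    field
      place : Config → Fin n
      move  : ∀ i (cs : Vec Config (suc (suc i))) (rs : Vec (Fin n) (suc i)) →
              Σ (Fin n) λ r' → Move (head rs) r'

  history : CopStrategy → RobberStrategy → (i : ℕ) →
            Vec Config (suc i) × Vec (Fin n) (suc i)
  history σ ρ zero =
    (CopStrategy.place σ ∷ []) , (RobberStrategy.place ρ (CopStrategy.place σ) ∷ [])
  history σ ρ (suc i) =
    let cs = proj₁ (history σ ρ i)
        rs = proj₂ (history σ ρ i)
        c' = proj₁ (CopStrategy.move σ i cs rs)
        r' = proj₁ (RobberStrategy.move ρ i (c' ∷ cs) rs)
    in (c' ∷ cs) , (r' ∷ rs)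

  copsAt : CopStrategy → RobberStrategy → ℕ → Config
  copsAt σ ρ i = head (proj₁ (history σ ρ i))

  robberAt : CopStrategy → RobberStrategy → ℕ → Fin n
  robberAt σ ρ i = head (proj₂ (history σ ρ i))

  -- capture in round i: a cop is on the robber's vertex after the robber's
  -- placement/move of round i, or after the cops' subsequent move.
  CapturedAt : CopStrategy → RobberStrategy → ℕ → Set
  CapturedAt σ ρ i = ∃ λ (j : Fin k) →
    copsAt σ ρ i j ≡ robberAt σ ρ i ⊎ copsAt σ ρ (suc i) j ≡ robberAt σ ρ i

  CopsWin : Set
  CopsWin = Σ CopStrategy λ σ → ∀ (ρ : RobberStrategy) → ∃ λ i → CapturedAt σ ρ i

CopNumberIs : ∀ {n} → Graph n → ℕ → Set
CopNumberIs G k = CopsWin G k × (∀ m → m Data.Nat.< k → ¬ CopsWin G m)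

CopNumber≤ : ∀ {n} → Graph n → ℕ → Set
CopNumber≤ G k = ∃ λ m → m ≤ k × CopsWin G m

{-# OPTIONS --safe #-}

-- That three cops are needed on the Petersen graph follows from its girth: a cop who is not
-- on the robber's vertex guards at most one of its three neighbours.  Three cops suffice
-- because there is a dominating set of size three.
--
-- For the other graphs, consider partial graphs, in which each pair of vertices is an edge, a
-- non-edge or undecided.  Two cops win on every connected completion of a partial graph as
-- soon as they win the game in which they may only use edges while the robber may also use
-- undecided pairs; connectivity enters through a further move, in which one cop pins the
-- robber inside a region while the other walks anywhere.  If they do not yet win, branch on
-- an undecided pair.  A partial graph settled once serves, up to relabelling, in all later
-- branches.  Proceeding through the stars K₁,₅, K₁,₄, …, K₁,₀ bounds the maximum degree
-- more and more tightly, and the only completion that escapes the cops is the Petersen graph.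

module Submission where

open import Defs
open import Data.Bool using (Bool; true; false; T; _∧_; _∨_; not; if_then_else_)
open import Data.Bool.Properties using (∧-conicalˡ; ∧-conicalʳ; T-≡) renaming (_≟_ to _≟ᵇ_)
open import Data.Empty using (⊥-elim)
open import Data.Fin using (Fin; zero; suc; _≟_)
open import Data.Fin.Patterns using (0F; 1F; 2F; 4F)
open import Data.Fin.Permutation using (Permutation′; permutation; id; flip; _∘ₚ_; _⟨$⟩ʳ_; _⟨$⟩ˡ_; inverseˡ; inverseʳ)
open import Data.Fin.Properties using (any?; all?)
open import Data.List using (List; []; _∷_; foldl)
open import Data.List.Relation.Unary.All using (All; []; _∷_)
open import Data.Maybe using (Maybe; just; nothing; fromMaybe)
open import Data.Maybe.Properties using (just-injective)
open import Data.Nat using (ℕ; zero; suc; s≤s; _<_; _/_; _≡ᵇ_)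
open import Data.Nat.DivMod using (_mod_)
open import Data.Nat.Properties using (≤-refl)
open import Data.Product using (∃; _×_; _,_; proj₁; proj₂)
open import Data.Sum using (_⊎_; inj₁; inj₂; [_,_]′)
open import Data.Vec using (Vec; []; _∷_; head; lookup; tabulate; zipWith; map; replicate; reverse; _[_]≔_)
open import Data.Vec.Properties using (lookup∘tabulate; lookup-map; lookup-zipWith; lookup-replicate; lookup∘update; lookup∘update′)
open import Function using (_∘_; _$_; Equivalence)
open import Relation.Nullary using (¬_; Dec; yes; no; does; contradiction)
open import Relation.Nullary.Decidable using (_⊎-dec_; _×-dec_; _→-dec_; ¬?; from-yes)
open import Relation.Binary.PropositionalEquality using (_≡_; _≢_; refl; sym; trans; cong; cong₂; subst)

-- From winning positions to strategies

-- The obstacle is size: ten vertices have 45 pairs, too many graphs to list. Hence reflection: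
-- trees and lists of steps are certificates, tested by Boolean functions that the type checker
-- evaluates, and soundness is proved once, in `check-valid`. The stars give the order because of
-- confinement. A cop on the centre of K₁,ₖ keeps the robber among the 9 - k vertices outside, where
-- the other cop hunts him. A lone cop wins on every connected chordal graph, so resistance needs an
-- induced cycle of length at least four out there: a 4-cycle for k = 5, also a pentagon for k = 4,
-- also a hexagon for k = 3. The hexagon is what remains of the Petersen graph when a vertex and its
-- neighbours are removed. As the outside grows, the graph gets sparser: a branch in which some
-- vertex reaches a degree already settled closes at once by citing that star.

module Strategies {n : ℕ} (G : Graph n) (k : ℕ) where

  V : Set
  V = Fin n

  infix 4 _↝_ _↝?_

  _↝_ : V → V → Set
  _↝_ = Move G k

  _↝?_ : ∀ u v → Dec (u ↝ v)
  u ↝? v = (u ≟ v) ⊎-dec (adj G u v ≟ᵇ true)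

  -- Positions with the cops to move from which they can force a capture.
  data Win (c : Config G k) (r : V) : Set where
    capture : ∀ j → c j ↝ r → Win c r
    advance : ∀ c′ → (∀ j → c j ↝ c′ j) → (∀ r′ → r ↝ r′ → Win c′ r′) → Win c r

  module _ (c₀ : Config G k) (w₀ : ∀ r → Win c₀ r) where

    Position : Set
    Position = ∃ λ c → ∃ λ r → Win c r

    -- A strategy must be total: after an illegal robber move, or when a capture is already due, the
    -- position is left as it is.
    respond : Position → V → Position
    respond p@(c , r , capture _ _)    r′ = p
    respond p@(c , r , advance c′ _ f) r′ with r ↝? r′
    ... | yes m = c′ , r′ , f r′ m
    ... | no  _ = p

    replay : ∀ {i} → Vec V (suc i) → Position
    replay (r ∷ [])          = c₀ , r , w₀ r
    replay (r′ ∷ rs@(_ ∷ _)) = respond (replay rs) r′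

    -- At a `capture` all cops aim at the robber; one of them can reach him, and `approach` lets the
    -- others stay put.
    target : Position → Config G k
    target (c , r , capture _ _)    j = r
    target (c , r , advance c′ _ _) j = c′ j

    approach : ∀ u v → ∃ λ w → u ↝ w
    approach u v with u ↝? v
    ... | yes m = v , m
    ... | no  _ = u , inj₁ refl

    approach-↝ : ∀ {u v} → u ↝ v → proj₁ (approach u v) ≡ v
    approach-↝ {u} {v} m with u ↝? v
    ... | yes _ = refl
    ... | no ¬m = contradiction m ¬m

    -- The winning tree is recovered from the robber's moves alone; the cops'
    -- history only serves to keep the moves legal off the main line.
    strategy : CopStrategy G k
    strategy = record
      { place = c₀
      ; move  = λ i cs rs → let t = target (replay rs) in
          (λ j → proj₁ (approach (head cs j) (t j))) , λ j → proj₂ (approach (head cs j) (t j))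
      }

    module _ (ρ : RobberStrategy G k) where

      cops : ℕ → Config G k
      cops = copsAt G k strategy ρ

      robber : ℕ → V
      robber = robberAt G k strategy ρ

      position : ℕ → Position
      position i = replay (proj₂ (history G k strategy ρ i))

      -- `replay` computes on a new move only once the older history is exposed as a cons, hence the
      -- `with`.
      position-suc : ∀ i → position (suc i) ≡ respond (position i) (robber (suc i))
      position-suc i with proj₂ (history G k strategy ρ i)
      ... | _ ∷ _ = refl

      robber-↝ : ∀ i → robber i ↝ robber (suc i)
      robber-↝ i = proj₂ (RobberStrategy.move ρ i _ (proj₂ (history G k strategy ρ i)))

      cops-suc : ∀ i j {c r w} → position i ≡ (c , r , w) → cops i j ≡ c j →
                 c j ↝ target (c , r , w) j → cops (suc i) j ≡ target (c , r , w) j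
      cops-suc i j refl e m = approach-↝ (subst (λ u → u ↝ target (position i) j) (sym e) m)

      -- The decision procedure supplies its own proof `m′` of the move, perhaps not the given one,
      -- and the subtree is taken at `m′`; hence the existential.
      respond-advance : ∀ {c r c′ m f r′} → r ↝ r′ →
        ∃ λ m′ → respond (c , r , advance c′ m f) r′ ≡ (c′ , r′ , f r′ m′)
      respond-advance {r = r} {r′ = r′} q with r ↝? r′
      ... | yes m′ = m′ , refl
      ... | no ¬q  = contradiction q ¬q

      -- Recursion on the winning tree, along which every play is finite. The invariant is that the
      -- replayed position is the actual one; configurations being functions, it is kept pointwise.
      captured : ∀ i {c r} (w : Win c r) → position i ≡ (c , r , w) →
                 (∀ j → cops i j ≡ c j) → robber i ≡ r → ∃ (CapturedAt G k strategy ρ)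
      captured i (capture j m) p e refl = i , j , inj₂ (cops-suc i j p (e j) m)
      captured i {c} {r} (advance c′ m f) p e refl =
        let m′ , q = respond-advance {c} {r} {c′} {m} {f} (robber-↝ i)
        in captured (suc i) (f (robber (suc i)) m′)
             (trans (position-suc i) (trans (cong (λ x → respond x (robber (suc i))) p) q))
             (λ j → cops-suc i j p (e j) (m j)) refl

    Win⇒CopsWin : CopsWin G k
    Win⇒CopsWin = strategy , λ ρ → captured ρ 0 (w₀ _) refl (λ _ → refl) refl

  Safe : Config G k → V → Set
  Safe c r = ∀ j → ¬ (c j ↝ r)

  -- After each robber move no cop is within one step of him. The next cop move therefore misses
  -- him, and the second hypothesis restores this invariant.
  evasion⇒¬CopsWin : (∀ c → ∃ (Safe c)) →
                     (∀ c r → (∀ j → c j ≢ r) → ∃ λ r′ → r ↝ r′ × Safe c r′) → ¬ CopsWin G k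
  evasion⇒¬CopsWin start evade (σ , win) =
    let i , j , cap = win ρ in uncaptured i j cap
    where
    flee : ∀ c r → ∃ λ r′ → r ↝ r′ × ((∀ j → c j ≢ r) → Safe c r′)
    flee c r with any? (λ j → c j ≟ r)
    -- The strategy must answer even after a capture; the promise of safety is then vacuous.
    ... | yes (j , e) = r , inj₁ refl , λ free → ⊥-elim (free j e)
    ... | no ¬caught  = let r′ , m , s = evade c r (λ j e → ¬caught (j , e)) in r′ , m , λ _ → s

    ρ : RobberStrategy G k
    ρ = record
      { place = λ c → proj₁ (start c)
      ; move  = λ i cs rs → let r′ , m , _ = flee (head cs) (head rs) in r′ , m
      }

    cops-↝ : ∀ i j → copsAt G k σ ρ i j ↝ copsAt G k σ ρ (suc i) j
    cops-↝ i j = proj₂ (CopStrategy.move σ i _ (proj₂ (history G k σ ρ i))) j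

    safe : ∀ i → Safe (copsAt G k σ ρ i) (robberAt G k σ ρ i)
    missed : ∀ i j → copsAt G k σ ρ (suc i) j ≢ robberAt G k σ ρ i

    safe zero    = proj₂ (start _)
    safe (suc i) = proj₂ (proj₂ (flee _ _)) (missed i)

    missed i j e = safe i j (subst (copsAt G k σ ρ i j ↝_) e (cops-↝ i j))

    uncaptured : ∀ i j → ¬ (copsAt G k σ ρ i j ≡ robberAt G k σ ρ i
                          ⊎ copsAt G k σ ρ (suc i) j ≡ robberAt G k σ ρ i)
    uncaptured i j (inj₁ e) = safe i j (inj₁ e)
    uncaptured i j (inj₂ e) = missed i j e

-- The Petersen graph

module _ where

  -- `Move` unfolds to the same type for every number of cops, so what is decided at index 0 serves
  -- for one, two and three cops.
  open Strategies Petersen 0 using (_↝_; _↝?_)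

  Petersen-diameter : ∀ u v → ∃ λ w → u ↝ w × w ↝ v
  Petersen-diameter = from-yes (all? λ u → all? λ v → any? λ w → (u ↝? w) ×-dec (w ↝? v))

  Petersen-connected : Connected Petersen
  Petersen-connected u v = let w , p , q = Petersen-diameter u v in extend q (extend p here)
    where
    extend : ∀ {v w} → v ↝ w → Reach Petersen u v → Reach Petersen u w
    extend (inj₁ refl) p = p
    extend (inj₂ e)    p = step p e

  Petersen-escape : ∀ a b r → a ≢ r → b ≢ r → ∃ λ r′ → r ↝ r′ × ¬ (a ↝ r′) × ¬ (b ↝ r′)
  Petersen-escape = from-yes (all? λ a → all? λ b → all? λ r →
    ¬? (a ≟ r) →-dec (¬? (b ≟ r) →-dec any? λ r′ → (r ↝? r′) ×-dec (¬? (a ↝? r′) ×-dec ¬? (b ↝? r′))))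

  -- Two closed neighbourhoods have four vertices each and cover at most eight of the ten.
  Petersen-undominated : ∀ a b → ∃ λ r → ¬ (a ↝ r) × ¬ (b ↝ r)
  Petersen-undominated = from-yes (all? λ a → all? λ b → any? λ r → ¬? (a ↝? r) ×-dec ¬? (b ↝? r))

  -- Vertices 0, 1 and 4 are the pairs {0,1}, {0,2} and {1,2}; any other pair has at most one point
  -- in {0,1,2}, so it is disjoint from one of them.
  Petersen-dominated : ∀ r → (0F ↝ r) ⊎ (1F ↝ r) ⊎ (4F ↝ r)
  Petersen-dominated = from-yes (all? λ r → (0F ↝? r) ⊎-dec ((1F ↝? r) ⊎-dec (4F ↝? r)))

  Petersen-CopsWin-3 : CopsWin Petersen 3
  Petersen-CopsWin-3 = Win⇒CopsWin c₀ λ r → case (Petersen-dominated r)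
    where
    open Strategies Petersen 3 using (Win; capture; Win⇒CopsWin)

    c₀ : Config Petersen 3
    c₀ 0F = 0F
    c₀ 1F = 1F
    c₀ 2F = 4F

    case : ∀ {r} → (0F ↝ r) ⊎ (1F ↝ r) ⊎ (4F ↝ r) → Win c₀ r
    case (inj₁ m)        = capture 0F m
    case (inj₂ (inj₁ m)) = capture 1F m
    case (inj₂ (inj₂ m)) = capture 2F m

  Petersen-¬CopsWin : ∀ m → m < 3 → ¬ CopsWin Petersen m
  Petersen-¬CopsWin 0 _ = Strategies.evasion⇒¬CopsWin Petersen 0
    (λ _ → 0F , λ ()) (λ _ r _ → r , inj₁ refl , λ ())
  Petersen-¬CopsWin 1 _ = Strategies.evasion⇒¬CopsWin Petersen 1
    -- One cop is treated as two cops on the same vertex.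
    (λ c → let r , s , _ = Petersen-undominated (c 0F) (c 0F) in r , λ { 0F → s })
    (λ c r free → let r′ , m , s , _ = Petersen-escape (c 0F) (c 0F) r (free 0F) (free 0F)
                  in r′ , m , λ { 0F → s })
  Petersen-¬CopsWin 2 _ = Strategies.evasion⇒¬CopsWin Petersen 2
    (λ c → let r , s , t = Petersen-undominated (c 0F) (c 1F) in r , λ { 0F → s ; 1F → t })
    (λ c r free → let r′ , m , s , t = Petersen-escape (c 0F) (c 1F) r (free 0F) (free 1F)
                  in r′ , m , λ { 0F → s ; 1F → t })
  Petersen-¬CopsWin (suc (suc (suc _))) (s≤s (s≤s (s≤s ())))

-- Boolean tests

∨-true : ∀ x {y} → x ∨ y ≡ true → x ≡ true ⊎ y ≡ true
∨-true true  _ = inj₁ refl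
∨-true false p = inj₂ p

true≢false : ∀ {x} → x ≡ true → x ≢ false
true≢false refl ()

does-true : ∀ {A : Set} (a? : Dec A) → does a? ≡ true → A
does-true (yes a) _ = a

every : ∀ {n} → (Fin n → Bool) → Bool
every {zero}  f = true
every {suc n} f = f zero ∧ every (f ∘ suc)

every-true : ∀ {n} (f : Fin n → Bool) → every f ≡ true → ∀ i → f i ≡ true
every-true f p zero    = ∧-conicalˡ _ _ p
every-true f p (suc i) = every-true (f ∘ suc) (∧-conicalʳ _ _ p) i

Subset : Set
Subset = Vec Bool 10

infix 4 _⊑_ _∈_
infixr 6 _∪_

_∈_ : ∀ {n} → Fin n → Vec Bool n → Set
i ∈ A = lookup A i ≡ true

_⊑_ : ∀ {n} → Vec Bool n → Vec Bool n → Bool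
[]          ⊑ []      = true
(true  ∷ A) ⊑ (b ∷ B) = b ∧ (A ⊑ B)
(false ∷ A) ⊑ (b ∷ B) = A ⊑ B

⊑-true : ∀ {n} (A B : Vec Bool n) → (A ⊑ B) ≡ true → ∀ i → i ∈ A → i ∈ B
⊑-true (true  ∷ A) (b ∷ B) p zero    _ = ∧-conicalˡ _ _ p
⊑-true (true  ∷ A) (b ∷ B) p (suc i) q = ⊑-true A B (∧-conicalʳ b _ p) i q
⊑-true (false ∷ A) (b ∷ B) p (suc i) q = ⊑-true A B p i q

_∪_ : Subset → Subset → Subset
_∪_ = zipWith _∨_

∪-true : ∀ A B {i} → i ∈ A ∪ B → i ∈ A ⊎ i ∈ B
∪-true A B {i} p = ∨-true (lookup A i) (trans (sym (lookup-zipWith _∨_ i A B)) p)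

∅ : Subset
∅ = replicate 10 false

∉∅ : ∀ i → ¬ (i ∈ ∅)
∉∅ i p = true≢false p (lookup-replicate i false)

full : Subset
full = replicate 10 true

-- Two cops

module _ (G : Graph 10) where

  open Strategies G 2 using (_↝_; Win; capture; advance; Win⇒CopsWin)

  -- With the two cops as separate arguments instead of a function on `Fin 2`, exchanging them is a
  -- plain recursion, free of equality between functions.
  data Win₂ (a b r : Fin 10) : Set where
    captureˡ : a ↝ r → Win₂ a b r
    captureʳ : b ↝ r → Win₂ a b r
    advance  : ∀ {a′ b′} → a ↝ a′ → b ↝ b′ → (∀ r′ → r ↝ r′ → Win₂ a′ b′ r′) → Win₂ a b r

  Win₂-swap : ∀ {a b r} → Win₂ a b r → Win₂ b a r
  Win₂-swap (captureˡ m)    = captureʳ m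
  Win₂-swap (captureʳ m)    = captureˡ m
  Win₂-swap (advance m n f) = advance n m λ r′ q → Win₂-swap (f r′ q)

  pair : Fin 10 → Fin 10 → Config G 2
  pair a b 0F = a
  pair a b 1F = b

  Win₂⇒Win : ∀ {a b r} → Win₂ a b r → Win (pair a b) r
  Win₂⇒Win (captureˡ m) = capture 0F m
  Win₂⇒Win (captureʳ m) = capture 1F m
  Win₂⇒Win (advance {a′} {b′} m n f) =
    advance (pair a′ b′) (λ { 0F → m ; 1F → n }) λ r′ q → Win₂⇒Win (f r′ q)

  Win₂⇒CopsWin : ∀ a b → (∀ r → Win₂ a b r) → CopsWin G 2
  Win₂⇒CopsWin a b w = Win⇒CopsWin (pair a b) (Win₂⇒Win ∘ w)

  -- While the first cop confines the robber to K, the second one can walk anywhere.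
  Win₂-walk : ∀ (K : Fin 10 → Set) {a t} →
              (∀ {r} → K r → ∀ r′ → r ↝ r′ → K r′ ⊎ a ↝ r′) → (∀ {r} → K r → Win₂ a t r) →
              ∀ {b} → Reach G t b → ∀ {r} → K r → Win₂ a b r
  Win₂-walk K closed w here k = w k
  -- The path runs from the target to the cop, so the edge exposed by `step` is the cop's next move,
  -- taken backwards.
  Win₂-walk K closed w (step {v} {b} p e) k = advance (inj₁ refl) (inj₂ (trans (adj-sym G b v) e)) λ r′ q →
    [ Win₂-walk K closed w p , captureˡ ]′ (closed k r′ q)

-- Partial graphs

Partial : Set
Partial = Vec (Vec (Maybe Bool) 10) 10

_⟦_,_⟧ : Partial → Fin 10 → Fin 10 → Maybe Bool
M ⟦ i , j ⟧ = lookup (lookup M i) j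

blank : Partial
blank = tabulate λ i → tabulate λ j → if does (i ≟ j) then just false else nothing

assign₁ : Fin 10 → Fin 10 → Bool → Partial → Partial
assign₁ i j b M = M [ i ]≔ (lookup M i [ j ]≔ just b)

assign : Fin 10 → Fin 10 → Bool → Partial → Partial
assign i j b = assign₁ i j b ∘ assign₁ j i b

-- `π` sends the labels of `M` to vertices of `G`. Leaving it variable is what makes a settled shape
-- reusable under relabelling.
record Extends (G : Graph 10) (π : Permutation′ 10) (M : Partial) : Set where
  constructor extends
  field known : ∀ i j {b} → M ⟦ i , j ⟧ ≡ just b → adj G (π ⟨$⟩ʳ i) (π ⟨$⟩ʳ j) ≡ b

open Extends

Extends-blank : ∀ G π → Extends G π blank
known (Extends-blank G π) i j p
  rewrite lookup∘tabulate (λ i → tabulate λ j → if does (i ≟ j) then just false else nothing) i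
        | lookup∘tabulate (λ j → if does (i ≟ j) then just false else nothing) j
  with i ≟ j | p
... | yes refl | refl = adj-irrefl G (π ⟨$⟩ʳ i)

Extends-assign₁ : ∀ {G π} M i j {b} → adj G (π ⟨$⟩ʳ i) (π ⟨$⟩ʳ j) ≡ b →
                  Extends G π M → Extends G π (assign₁ i j b M)
known (Extends-assign₁ M i j {b} e x) k l p with k ≟ i
... | no k≢i rewrite lookup∘update′ k≢i M (lookup M i [ j ]≔ just b) = known x k l p
... | yes refl rewrite lookup∘update k M (lookup M k [ j ]≔ just b) with l ≟ j
...   | no l≢j rewrite lookup∘update′ l≢j (lookup M k) (just b) = known x k l p
...   | yes refl rewrite lookup∘update l (lookup M k) (just b) = trans e (just-injective p)

Extends-assign : ∀ {G π} M i j {b} → adj G (π ⟨$⟩ʳ i) (π ⟨$⟩ʳ j) ≡ b →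
                 Extends G π M → Extends G π (assign i j b M)
Extends-assign {G} M i j {b} e x =
  Extends-assign₁ (assign₁ j i b M) i j e (Extends-assign₁ M j i (trans (adj-sym G _ _) e) x)

-- Closed neighbourhoods, since staying put is a move. The default `false` withholds undecided pairs
-- from the cops, and underestimating their moves is safe.
certain : Partial → Vec Subset 10
certain M = tabulate λ i → tabulate λ j → does (i ≟ j) ∨ fromMaybe false (M ⟦ i , j ⟧)

-- The default `true` grants undecided pairs to the robber: his moves may only be overestimated.
possible : Partial → Vec Subset 10
possible M = tabulate λ i → tabulate λ j → does (i ≟ j) ∨ fromMaybe true (M ⟦ i , j ⟧)

module _ {G : Graph 10} (π : Permutation′ 10) {M : Partial} (x : Extends G π M) where

  open Strategies G 2 using (_↝_)

  certain-sound : ∀ i {j} → j ∈ lookup (certain M) i → π ⟨$⟩ʳ i ↝ π ⟨$⟩ʳ j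
  certain-sound i {j} p
    rewrite lookup∘tabulate (λ i → tabulate λ j → does (i ≟ j) ∨ fromMaybe false (M ⟦ i , j ⟧)) i
          | lookup∘tabulate (λ j → does (i ≟ j) ∨ fromMaybe false (M ⟦ i , j ⟧)) j
    with ∨-true (does (i ≟ j)) p
  ... | inj₁ e = inj₁ (cong (π ⟨$⟩ʳ_) (does-true (i ≟ j) e))
  ... | inj₂ e with M ⟦ i , j ⟧ in eq | e
  ...   | just true | refl = inj₂ (known x i j eq)

  possible-complete : ∀ i j → π ⟨$⟩ʳ i ↝ π ⟨$⟩ʳ j → j ∈ lookup (possible M) i
  possible-complete i j m
    rewrite lookup∘tabulate (λ i → tabulate λ j → does (i ≟ j) ∨ fromMaybe true (M ⟦ i , j ⟧)) i
          | lookup∘tabulate (λ j → does (i ≟ j) ∨ fromMaybe true (M ⟦ i , j ⟧)) j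
    with i ≟ j | M ⟦ i , j ⟧ in eq
  ... | yes _ | _ = refl
  ... | no _  | nothing = refl
  ... | no _  | just true = refl
  ... | no i≢j | just false with m
  ...   | inj₁ e = contradiction (trans (sym (inverseˡ π)) (trans (cong (π ⟨$⟩ˡ_) e) (inverseˡ π))) i≢j
  ...   | inj₂ e = contradiction (known x i j eq) (true≢false e)

-- Decimal notation: vertices are digits, and a numeral stands for a tuple of vertices.

vertex high low : ℕ → Fin 10
vertex n = n mod 10
high   n = vertex (n / 10)
low    n = vertex n

digits : ∀ k → ℕ → Vec (Fin 10) k
digits zero    n = []
digits (suc k) n = vertex n ∷ digits k (n / 10)

-- Elements are listed in decreasing order, because a leading 0 would be lost.
toSubset : ℕ → Subset
toSubset = go 10
  where
  go : ℕ → ℕ → Subset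
  go zero    n = ∅
  go (suc k) n = (if n / 10 ≡ᵇ 0 then ∅ else go k (n / 10)) [ vertex n ]≔ true

-- A pair {i, j} with i > j is the numeral ij, and a set of pairs their concatenation.
assigns : Bool → ℕ → Partial → Partial
-- Ten vertices have 45 pairs, so this fuel suffices for any list without repetition. As i > j, a
-- pair never starts with 0, and the numeral vanishes only when it is used up.
assigns b = go 45
  where
  go : ℕ → ℕ → Partial → Partial
  go zero    n M = M
  go (suc k) n M = if n ≡ᵇ 0 then M else go k (n / 100) (assign (high n) (low n) b M)

-- Certificates

-- In move aba′b′ the cops go from a, b to a′, b′.  In walk abt K the cop at a stays and
-- confines the robber to K, while the other one walks from b to t.
data Step : Set where
  move : ℕ → Step
  walk : ℕ → ℕ → Step

-- Two cop positions and a set of robber positions from which the cops, to move, win.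
Fact : Set
Fact = Fin 10 × Fin 10 × Subset

module Check (S O : Vec Subset 10) where

  matches : Fin 10 → Fin 10 → Fact → Bool
  matches a b (c , d , _) = (does (a ≟ c) ∧ does (b ≟ d)) ∨ (does (a ≟ d) ∧ does (b ≟ c))

  won : Fin 10 → Fin 10 → List Fact → Subset
  won a b []       = lookup S a ∪ lookup S b
  won a b (f ∷ fs) = if matches a b f then proj₂ (proj₂ f) ∪ won a b fs else won a b fs

  -- `A` is the set guarded by the standing cop: the robber can leave `K` only to be caught.
  confinedAt : Subset → Subset → Fin 10 → Bool
  confinedAt K A r = not (lookup K r) ∨ (lookup O r ⊑ K ∪ A)

  confined : Subset → Subset → Bool
  confined K A = every (confinedAt K A)

  -- An illegal move yields the empty set instead of a failure, so every list of steps produces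
  -- sound facts and no separate test of legality is required.
  pursue : (a b a′ b′ : Fin 10) → List Fact → Fact
  pursue a b a′ b′ fs = a , b ,
    (if lookup (lookup S a) a′ ∧ lookup (lookup S b) b′ then map (_⊑ won a′ b′ fs) O else ∅)

  relocate : (a b t : Fin 10) → Subset → List Fact → Fact
  relocate a b t K fs = a , b , (if confined K (lookup S a) ∧ (K ⊑ won a t fs) then K else ∅)

  derive : Step → List Fact → Fact
  derive (move n)   = pursue (vertex (n / 1000)) (vertex (n / 100)) (vertex (n / 10)) (vertex n)
  derive (walk n k) = relocate (vertex (n / 100)) (vertex (n / 10)) (vertex n) (toSubset k)

  -- Retrograde analysis: each step may use the facts before it, so a certificate runs backwards
  -- from the captures.
  facts : List Step → List Fact
  facts = foldl (λ fs s → derive s fs ∷ fs) []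

  wins : List Step → Fin 10 → Fin 10 → Bool
  wins ss a b = full ⊑ won a b (facts ss)

-- Soundness of the certificates

module Soundness {G : Graph 10} (conn : Connected G) (π : Permutation′ 10) (S O : Vec Subset 10)
  (S-sound : ∀ i {j} → j ∈ lookup S i → Move G 2 (π ⟨$⟩ʳ i) (π ⟨$⟩ʳ j))
  (O-complete : ∀ i j → Move G 2 (π ⟨$⟩ʳ i) (π ⟨$⟩ʳ j) → j ∈ lookup O i) where

  open Strategies G 2 using (_↝_)
  open Check S O

  Sound : Fact → Set
  Sound (a , b , W) = ∀ {r} → r ∈ W → Win₂ G (π ⟨$⟩ʳ a) (π ⟨$⟩ʳ b) (π ⟨$⟩ʳ r)

  -- The robber moves on vertices of `G` while facts speak of labels; surjectivity of `π` bridges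
  -- the two.
  onto : ∀ (P : Fin 10 → Set) → (∀ i → P (π ⟨$⟩ʳ i)) → ∀ v → P v
  onto P p v = subst P (inverseʳ π) (p (π ⟨$⟩ˡ v))

  matches-sound : ∀ a b f {r} → matches a b f ≡ true → Sound f → r ∈ proj₂ (proj₂ f) →
                  Win₂ G (π ⟨$⟩ʳ a) (π ⟨$⟩ʳ b) (π ⟨$⟩ʳ r)
  matches-sound a b (c , d , W) m s p with ∨-true (does (a ≟ c) ∧ does (b ≟ d)) m
  ... | inj₁ e with does-true (a ≟ c) (∧-conicalˡ _ _ e) | does-true (b ≟ d) (∧-conicalʳ (does (a ≟ c)) _ e)
  ...   | refl | refl = s p
  matches-sound a b (c , d , W) m s p | inj₂ e
      with does-true (a ≟ d) (∧-conicalˡ _ _ e) | does-true (b ≟ c) (∧-conicalʳ (does (a ≟ d)) _ e)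
  ...   | refl | refl = Win₂-swap G (s p)

  won-sound : ∀ {fs} → All Sound fs → ∀ a b → Sound (a , b , won a b fs)
  won-sound [] a b p with ∪-true (lookup S a) (lookup S b) p
  ... | inj₁ q = captureˡ (S-sound a q)
  ... | inj₂ q = captureʳ (S-sound b q)
  won-sound (_∷_ {f} {fs} s ss) a b p with matches a b f in m
  ... | false = won-sound ss a b p
  ... | true with ∪-true (proj₂ (proj₂ f)) (won a b fs) p
  ...   | inj₁ q = matches-sound a b f m s q
  ...   | inj₂ q = won-sound ss a b q

  confined-sound : ∀ K A → confined K A ≡ true → ∀ {r} → r ∈ K →
                   ∀ r′ → π ⟨$⟩ʳ r ↝ π ⟨$⟩ʳ r′ → r′ ∈ K ⊎ r′ ∈ A
  confined-sound K A c {r} k r′ m with ∨-true (not (lookup K r)) (every-true (confinedAt K A) c r)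
  ... | inj₁ e rewrite k = contradiction e λ ()
  ... | inj₂ e = ∪-true K A (⊑-true (lookup O r) (K ∪ A) e r′ (O-complete r r′ m))

  pursue-sound : ∀ a b a′ b′ {fs} → All Sound fs → Sound (pursue a b a′ b′ fs)
  pursue-sound a b a′ b′ {fs} ss {r} p with lookup (lookup S a) a′ ∧ lookup (lookup S b) b′ in legal
  ... | false = contradiction p (∉∅ r)
  ... | true  = advance
    (S-sound a (∧-conicalˡ _ _ legal))
    (S-sound b (∧-conicalʳ (lookup (lookup S a) a′) _ legal))
    (onto _ λ r′ m → won-sound ss a′ b′
      (⊑-true (lookup O r) W (trans (sym (lookup-map r (_⊑ W) O)) p) r′ (O-complete r r′ m)))
    where W = won a′ b′ fs

  relocate-sound : ∀ a b t K {fs} → All Sound fs → Sound (relocate a b t K fs)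
  relocate-sound a b t K {fs} ss {r} p with confined K (lookup S a) ∧ (K ⊑ won a t fs) in ok
  ... | false = contradiction p (∉∅ r)
  ... | true  = Win₂-walk G (λ v → π ⟨$⟩ˡ v ∈ K)
    (λ q → onto _ λ r′ m → [ (λ q′ → inj₁ (subst (_∈ K) (sym (inverseˡ π)) q′))
                           , (λ q′ → inj₂ (S-sound a q′)) ]′
      (confined-sound K (lookup S a) (∧-conicalˡ _ _ ok) q r′
        (subst (_↝ π ⟨$⟩ʳ r′) (sym (inverseʳ π)) m)))
    (λ q → subst (Win₂ G _ _) (inverseʳ π)
      (won-sound ss a t (⊑-true K _ (∧-conicalʳ (confined K (lookup S a)) _ ok) _ q)))
    (conn (π ⟨$⟩ʳ t) (π ⟨$⟩ʳ b)) (subst (_∈ K) (sym (inverseˡ π)) p)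

  derive-sound : ∀ s {fs} → All Sound fs → Sound (derive s fs)
  derive-sound (move n)   = pursue-sound (vertex (n / 1000)) (vertex (n / 100)) (vertex (n / 10)) (vertex n)
  derive-sound (walk n k) = relocate-sound (vertex (n / 100)) (vertex (n / 10)) (vertex n) (toSubset k)

  facts-sound : ∀ ss {fs} → All Sound fs → All Sound (foldl (λ fs s → derive s fs ∷ fs) fs ss)
  facts-sound []       p = p
  facts-sound (s ∷ ss) p = facts-sound ss (derive-sound s p ∷ p)

  wins-sound : ∀ ss a b → wins ss a b ≡ true → CopsWin G 2
  wins-sound ss a b p = Win₂⇒CopsWin G (π ⟨$⟩ʳ a) (π ⟨$⟩ʳ b) (onto _ λ r →
    won-sound (facts-sound ss []) a b (⊑-true full (won a b (facts ss)) p r (lookup-replicate r true)))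

  -- With `∅` in place of a guard, confinement says that no possible edge leaves `K`, so no path
  -- from `i` does.
  cut-sound : ∀ K i j → confined K ∅ ≡ true → i ∈ K → j ∈ K
  cut-sound K i j c i∈K = subst (_∈ K) (inverseˡ π) (reached (conn (π ⟨$⟩ʳ i) (π ⟨$⟩ʳ j)))
    where
    reached : ∀ {v} → Reach G (π ⟨$⟩ʳ i) v → π ⟨$⟩ˡ v ∈ K
    reached here = subst (_∈ K) (sym (inverseˡ π)) i∈K
    reached (step {v} {w} p e) = [ (λ q → q) , (λ q → contradiction q (∉∅ (π ⟨$⟩ˡ w))) ]′
      (confined-sound K ∅ c (reached p) (π ⟨$⟩ˡ w)
        (inj₂ (trans (cong₂ (adj G) (inverseʳ π) (inverseʳ π)) e)))

-- Derivations

Good : Graph 10 → Set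
Good G = CopsWin G 2 ⊎ G ≅ Petersen

Valid : Partial → Set
Valid M = ∀ {G} → Connected G → ∀ π → Extends G π M → Good G

-- Storing the proof with the shape lets a tree cite an earlier result at the cost of one embedding
-- test.
record Lemma : Set where
  field
    shape : Partial
    valid : Valid shape

open Lemma

-- The first branch of query ij assumes the edge ij, the second one its absence.  The numeral
-- in use lists the images of the vertices 0, …, 9; in cops it is the starting position;
-- cut K ij refutes connectivity, as i lies in the closed set K but j does not.
data Tree : Set where
  query : ℕ → Tree → Tree → Tree
  use   : Lemma → ℕ → Tree
  cops  : List Step → ℕ → Tree
  cut   : ℕ → ℕ → Tree

-- A missing entry is answered by the last index; `invertible` tests both composites and so rejects
-- such a vector.
index : ∀ {n} → Vec (Fin 10) (suc n) → Fin 10 → Fin (suc n)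
index {zero}  _        i = zero
index {suc n} (x ∷ xs) i = if does (x ≟ i) then zero else suc (index xs i)

-- Exactly ten digits are read, so here a leading 0 is not lost.
images : ℕ → Vec (Fin 10) 10
images n = reverse (digits 10 n)

invertible : Vec (Fin 10) 10 → Fin 10 → Bool
invertible ρ i = does (lookup ρ (index ρ i) ≟ i) ∧ does (index ρ (lookup ρ i) ≟ i)

isPermutation : Vec (Fin 10) 10 → Bool
isPermutation ρ = every (invertible ρ)

toPermutation : ∀ ρ → isPermutation ρ ≡ true → Permutation′ 10
toPermutation ρ p = permutation (lookup ρ) (index ρ)
  (λ i → does-true (lookup ρ (index ρ i) ≟ i) (∧-conicalˡ _ _ (every-true (invertible ρ) p i)))
  (λ i → does-true (index ρ (lookup ρ i) ≟ i)
           (∧-conicalʳ (does (lookup ρ (index ρ i) ≟ i)) _ (every-true (invertible ρ) p i)))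

-- The information order: a pair left open by the cited shape may have any status in the current
-- one.
_≼_ : Maybe Bool → Maybe Bool → Bool
nothing    ≼ _          = true
just true  ≼ just true  = true
just false ≼ just false = true
just _     ≼ _          = false

≼-true : ∀ {x y b} → (x ≼ y) ≡ true → x ≡ just b → y ≡ just b
≼-true {just true}  {just true}  _ refl = refl
≼-true {just false} {just false} _ refl = refl

embedsAt : Partial → Vec (Fin 10) 10 → Partial → Fin 10 → Fin 10 → Bool
embedsAt Q ρ M i j = (Q ⟦ i , j ⟧) ≼ (M ⟦ lookup ρ i , lookup ρ j ⟧)

embeds : Partial → Vec (Fin 10) 10 → Partial → Bool
embeds Q ρ M = every λ i → every (embedsAt Q ρ M i)

embeds-true : ∀ Q ρ M → embeds Q ρ M ≡ true → ∀ i j {b} →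
              Q ⟦ i , j ⟧ ≡ just b → M ⟦ lookup ρ i , lookup ρ j ⟧ ≡ just b
embeds-true Q ρ M p i j =
  ≼-true (every-true (embedsAt Q ρ M i) (every-true (λ i → every (embedsAt Q ρ M i)) p i) j)

check : Partial → Tree → Bool
check M (query e t u) = check (assign (high e) (low e) true M) t ∧ check (assign (high e) (low e) false M) u
check M (use L n)     = isPermutation (images n) ∧ embeds (shape L) (images n) M
check M (cops ss n)   = Check.wins (certain M) (possible M) ss (high n) (low n)
check M (cut k n)     = Check.confined (certain M) (possible M) (toSubset k) ∅
                      ∧ (lookup (toSubset k) (high n) ∧ not (lookup (toSubset k) (low n)))

check-valid : ∀ M t → check M t ≡ true → Valid M
check-valid M (query e t u) p {G} conn π x with adj G (π ⟨$⟩ʳ high e) (π ⟨$⟩ʳ low e) in eq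
... | true  = check-valid _ t (∧-conicalˡ _ _ p) conn π (Extends-assign M (high e) (low e) eq x)
... | false = check-valid _ u (∧-conicalʳ (check (assign (high e) (low e) true M) t) _ p) conn π
                (Extends-assign M (high e) (low e) eq x)
-- Composition is diagrammatic: labels of the cited shape go by `σ` to labels of `M`, then by `π` to
-- vertices of `G`.
check-valid M (use L n) p conn π x = valid L conn (σ ∘ₚ π) $ extends λ i j q → known x _ _
  (embeds-true (shape L) (images n) M (∧-conicalʳ (isPermutation (images n)) _ p) i j q)
  where σ = toPermutation (images n) (∧-conicalˡ _ _ p)
check-valid M (cops ss n) p conn π x = inj₁ (wins-sound ss (high n) (low n) p)
  where open Soundness conn π (certain M) (possible M) (certain-sound π x) (possible-complete π x)
check-valid M (cut k n) p conn π x = contradiction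
  (∧-conicalʳ (lookup K (high n)) _ q)
  λ r → true≢false (cut-sound K (high n) (low n) (∧-conicalˡ _ _ p) (∧-conicalˡ _ _ q)) (not-true r)
  where
  open Soundness conn π (certain M) (possible M) (certain-sound π x) (possible-complete π x)
  K = toSubset k

  q = ∧-conicalʳ (Check.confined (certain M) (possible M) K ∅) _ p

  not-true : ∀ {x} → not x ≡ true → x ≡ false
  not-true {false} _ = refl

-- When the check evaluates to `true`, its `T` is the unit type and the implicit argument is filled
-- by eta: stating a lemma runs its certificate.
lemma : ∀ (edges nonedges : ℕ) t →
        {T (check (assigns true edges (assigns false nonedges blank)) t)} → Lemma
lemma es ns t {p} = record
  { shape = assigns true es (assigns false ns blank)
  ; valid = check-valid _ t (Equivalence.to T-≡ p)
  }

-- All pairs are decided, so an extension of this shape is a copy of it. As `π` leads from the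
-- Petersen graph to `G`, the isomorphism asked for is its inverse.
petersen : Lemma
petersen = record { shape = P ; valid = λ {G} _ π x → inj₂ (flip π , λ u v →
    let i = π ⟨$⟩ˡ u ; j = π ⟨$⟩ˡ v in
    trans (sym (cong₂ (adj G) (inverseʳ π) (inverseʳ π))) (known x i j (P-adj i j))) }
  where
  P : Partial
  P = tabulate λ i → tabulate λ j → just (adj Petersen i j)

  P-adj : ∀ i j → P ⟦ i , j ⟧ ≡ just (adj Petersen i j)
  P-adj i j = trans
    (cong (λ row → lookup row j) (lookup∘tabulate (λ i → tabulate λ j → just (adj Petersen i j)) i))
    (lookup∘tabulate (λ j → just (adj Petersen i j)) j)

-- The case distinction

L1 : Lemma
L1 = lemma 1020304050768690 0
  (cops [] 06)

-- Only 6 is unguarded from 0 and 9. A robber there cannot step to 3 or 4, so the cop on 0 may go to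
-- 1. The pair 20 stays open because 9 guards 2; a smaller shape embeds in more branches.
L2 : Lemma
L2 = lemma 1030406192959798 6364
  (cops (move 0919 ∷ []) 09)

L3 : Lemma
L3 = lemma 10304092959798 606364
  (query 61 (use L2 0123456789) $
   cops (walk 906 6 ∷ []) 09)

L4 : Lemma
L4 = lemma 10203040507686959798 606364
  (query 92 (use L3 0123456789) $
   query 91 (use L3 0213456789) $
   query 85 (cops (move 5706 ∷ move 5709 ∷ []) 57) $
   query 84 (cops (move 4706 ∷ move 4707 ∷ move 4709 ∷ []) 47) $
   query 93 (cops (move 3606 ∷ move 3607 ∷ []) 36) $
   cops (move 5606 ∷ move 5607 ∷ []) 56)

L5 : Lemma
L5 = lemma 1020304050769798 86
  (cops (move 0709 ∷ []) 07)

L6 : Lemma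
L6 = lemma 10203040506162637686959798 60708090
  (query 94 (query 93 (use L4 6127830459) $
             query 92 (use L4 6137820459) $
             use L4 0452319786) $
   use L5 6123784095)

L7 : Lemma
L7 = lemma 10203040507686959798 6064708090
  (query 63 (query 62 (query 61 (use L6 0123456789) $
                       use L4 0231456789) $
             use L4 0132456789) $
   use L4 0123456789)

L8 : Lemma
L8 = lemma 10203040507686959798 60708090
  (query 64 (query 93 (query 92 (use L6 0235149786) $
                       use L7 0135249786) $
             use L7 0125349786) $
   use L7 0123456789)

-- The path 6-7-9-8 lies outside the star. The edge 86 closes it to a 4-cycle, which if induced
-- defeats a single cop; hence the long first branch.
L9 : Lemma
L9 = lemma 1020304050769798 0
  (query 86 (query 90 (use L1 0123456789) $
             query 80 (use L1 0123457698) $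
             query 70 (use L1 0123458697) $
             query 60 (use L1 0123459786) $
             query 81 (use L8 0234517698) $
             query 85 (use L8 0123457698) $
             query 84 (use L8 0123547698) $
             query 83 (use L8 0124537698) $
             query 82 (use L8 0134527698) $
             cops (walk 708 8 ∷ []) 07) $
   use L5 0123456789)

L10 : Lemma
L10 = lemma 10203040507698 0
  (query 97 (use L9 0123456789) $
   query 86 (use L9 0123457698) $
   query 87 (use L9 0123456798) $
   query 96 (use L9 0123457689) $
   cops (walk 068 98 ∷ []) 06)

L11 : Lemma
L11 = lemma 1020304050768797 0
  (cops [] 07)

L12 : Lemma
L12 = lemma 10203040509798 76
  (query 86 (use L10 0123456879) $
   query 96 (use L11 0123456978) $
   cops (walk 069 987 ∷ []) 06)

L13 : Lemma
L13 = lemma 102030405098 0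
  (query 76 (use L10 0123456789) $
   query 97 (use L12 0123456789) $
   query 87 (use L12 0123456798) $
   query 96 (use L12 0123457689) $
   query 86 (use L12 0123457698) $
   cops (walk 067 7 ∷ walk 068 98 ∷ []) 06)

star₅ : Lemma
star₅ = lemma 1020304050 0
  (query 98 (use L13 0123456789) $
   query 97 (use L13 0123456879) $
   query 96 (use L13 0123458769) $
   query 87 (use L13 0123456978) $
   query 86 (use L13 0123459768) $
   query 76 (use L13 0123458967) $
   cops (walk 067 7 ∷ walk 068 8 ∷ walk 069 9 ∷ []) 06)

-- A vertex of degree four

L14 : Lemma
L14 = lemma 1020304043647687959798 5162
  (cops (move 4907 ∷ move 4909 ∷ []) 49)

L15 : Lemma
L15 = lemma 10202130404352647687959798 50518090
  (query 62 (query 32 (use star₅ 2013564789) $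
             query 81 (cops (move 4907 ∷ move 6849 ∷ move 6949 ∷ move 4869 ∷ move 6869 ∷ move 1686 ∷ move 1684 ∷ []) 16) $
             query 92 (use star₅ 2015693784) $
             cops (move 4607 ∷ move 4707 ∷ move 4907 ∷ move 6749 ∷ move 6949 ∷ move 4769 ∷ move 6769 ∷
                   move 4667 ∷ move 4647 ∷ []) 46) $
   use L14 0123456789)

L16 : Lemma
L16 = lemma 102021304052768797 5354
  (cops (move 0727 ∷ []) 07)

L17 : Lemma
L17 = lemma 1020213040435264657687959798 508090
  (query 53 (query 51 (use star₅ 5123690784) $
             use L15 0123456789) $
   query 51 (query 54 (use star₅ 5124690783) $
             use L16 0123456789) $
   use L15 0123456789)

L18 : Lemma
L18 = lemma 10202130404364657687959798 508090
  (query 52 (use L17 0123456789) $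
   query 51 (use L17 0213456789) $
   cops (move 0749 ∷ []) 07)

L19 : Lemma
L19 = lemma 10203040959798 6061626364
  (cops (walk 906 6 ∷ []) 09)

L20 : Lemma
L20 = lemma 1020213040959798 606364
  (query 62 (use L16 0123465978) $
   query 61 (use L16 0213465978) $
   use L19 0123456789)

L21 : Lemma
L21 = lemma 102021304043657687959798 50608090
  (query 64 (use L18 0123456789) $
   query 63 (use L18 0124356789) $
   use L20 0123456789)

L22 : Lemma
L22 = lemma 10203040436574879598 61627586
  (cops (move 0945 ∷ move 4945 ∷ move 0809 ∷ move 0849 ∷ []) 08)

L23 : Lemma
L23 = lemma 10202130404365748287949598 75858697
  (query 62 (cops (move 0642 ∷ move 0924 ∷ move 0506 ∷ move 0509 ∷ []) 05) $
   query 61 (cops (move 1424 ∷ move 0641 ∷ move 0914 ∷ move 0506 ∷ move 0509 ∷ []) 05) $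
   use L22 0123456789)

L24 : Lemma
L24 = lemma 10202130404365768287949598 7585869697
  (query 74 (use L23 0123456789) $
   query 73 (query 62 (use L23 0431259876) $
             query 61 (query 53 (use L23 0214398765) $
                       cops (move 0819 ∷ move 1419 ∷ move 0708 ∷ move 1314 ∷ move 2314 ∷ move 2380 ∷ move 1307 ∷
                             move 1323 ∷ []) 13) $
             use L22 0124356789) $
   use L22 0341267895)

L25 : Lemma
L25 = lemma 102021304043657687949598 7585869697
  (query 82 (use L24 0123456789) $
   query 81 (use L24 0213456789) $
   use L22 0123478956)

L26 : Lemma
L26 = lemma 10203040657698 80818283849091929394
  (cops (walk 608 98 ∷ []) 06)

L27 : Lemma
L27 = lemma 10202130406576879598 8083848590939497
  (query 92 (use L22 0341278956) $
   query 82 (use L22 0341259876) $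
   query 91 (use L22 0342178956) $
   query 81 (use L22 0342159876) $
   use L26 0123456789)

L28 : Lemma
L28 = lemma 1020304062657576919598 708384
  (cops (move 1605 ∷ move 2905 ∷ move 6961 ∷ move 6929 ∷ []) 69)

L29 : Lemma
L29 = lemma 1020304065757681919598 60708384
  (query 62 (use L28 0123456789) $
   query 72 (use L28 0123457689) $
   cops (move 1505 ∷ move 1509 ∷ []) 15)

L30 : Lemma
L30 = lemma 10203040657576879295 838491
  (cops (move 2705 ∷ move 2707 ∷ []) 27)

L31 : Lemma
L31 = lemma 10203040657576818287929598 6070
  (query 84 (use star₅ 8124796035) $
   query 83 (use star₅ 8123796045) $
   query 91 (use L29 0123456789) $
   use L30 0123456789)

L32 : Lemma
L32 = lemma 10203040436575768187929598 506070
  (query 82 (use L31 0123456789) $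
   query 91 (use L31 0213476598) $
   query 94 (use L14 0213489567) $
   query 93 (use L14 0214389567) $
   use L30 0213476598)

L33 : Lemma
L33 = lemma 102030404365768187959698 50607090
  (query 72 (use L32 0123465987) $
   query 71 (query 74 (use L31 0412395678) $
             use L29 0132495678) $
   use L20 0341257689)

L34 : Lemma
L34 = lemma 102030404365768792959798 5060708090
  (query 61 (use L33 0123489567) $
   query 64 (cops (move 0949 ∷ []) 09) $
   use L3 0321456789)

L35 : Lemma
L35 = lemma 10203040436264657481929598 2175858697
  (cops (move 4849 ∷ move 0148 ∷ move 0948 ∷ move 0209 ∷ move 0509 ∷ move 0605 ∷ move 0206 ∷
         move 0120 ∷ move 0420 ∷ move 0140 ∷ []) 01)

L36 : Lemma
L36 = lemma 10203040516582879598 60636475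
  (cops (move 1858 ∷ move 0818 ∷ move 0918 ∷ move 0809 ∷ []) 08)

L37 : Lemma
L37 = lemma 102030404351657476819495 828697
  (cops (move 0541 ∷ move 4541 ∷ move 0605 ∷ move 0645 ∷ []) 06)

L38 : Lemma
L38 = lemma 1020304043626574768187929598 216070758085869697
  (query 64 (use L35 0123456789) $
   query 91 (cops (move 0249 ∷ move 0549 ∷ move 0605 ∷ move 0206 ∷ move 0706 ∷ move 0420 ∷ move 0407 ∷
                   move 0807 ∷ move 0108 ∷ move 0140 ∷ []) 01) $
   query 41 (cops (move 0549 ∷ move 2494 ∷ move 4605 ∷ move 4642 ∷ []) 46) $
   query 51 (query 84 (use L35 0213498765) $
             query 94 (query 82 (query 63 (cops (move 0238 ∷ move 0602 ∷ move 0902 ∷ move 0506 ∷ move 0509 ∷ []) 05) $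
                                 use L36 0123456789) $
                       use L37 0123456789) $
             query 53 (cops (move 2506 ∷ move 5636 ∷ move 5652 ∷ move 5756 ∷ move 4975 ∷ move 0549 ∷ move 0105 ∷
                             move 0605 ∷ move 0206 ∷ move 0706 ∷ move 0407 ∷ move 0420 ∷ move 0807 ∷ move 0108 ∷
                             move 0140 ∷ []) 01) $
             cops (move 1206 ∷ move 1606 ∷ move 0821 ∷ move 2821 ∷ move 0708 ∷ move 1607 ∷ move 2807 ∷
                   move 1682 ∷ []) 16) $
   query 83 (cops (move 3607 ∷ move 0536 ∷ move 2363 ∷ move 3932 ∷ move 3905 ∷ []) 39) $
   cops (move 2707 ∷ move 4607 ∷ move 4707 ∷ move 0627 ∷ move 4972 ∷ move 0506 ∷ move 4506 ∷
         move 4505 ∷ move 4605 ∷ move 4905 ∷ move 4549 ∷ move 5794 ∷ move 5754 ∷ move 6754 ∷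
         move 4675 ∷ move 6757 ∷ move 4776 ∷ move 4746 ∷ []) 47)

L39 : Lemma
L39 = lemma 10203040436574768187929598 2150607075808586909697
  (query 62 (use L38 0123456789) $
   query 61 (query 54 (use L37 0123489567) $
             query 53 (use L38 0214376598) $
             cops (move 0819 ∷ move 2691 ∷ move 0708 ∷ move 0726 ∷ []) 07) $
   use L22 0123456789)

L40 : Lemma
L40 = lemma 102030406576819598 7072737486
  (cops (move 1586 ∷ move 0515 ∷ move 0915 ∷ move 0509 ∷ []) 05)

L41 : Lemma
L41 = lemma 102030404365768187929598 215060708090
  (query 75 (use L32 0123456789) $
   query 96 (use L33 0123456789) $
   query 86 (use L33 0213476598) $
   query 97 (use L34 0123456789) $
   query 85 (use L34 0213476598) $
   query 74 (use L39 0123456789) $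
   query 73 (use L39 0124356789) $
   query 72 (query 64 (use L39 0213495678) $
             query 63 (use L39 0214395678) $
             cops (move 1909 ∷ move 5891 ∷ move 8919 ∷ move 7989 ∷ move 7985 ∷ []) 79) $
   use L40 0123456789)

L42 : Lemma
L42 = lemma 1020304043657476929598 215063818697
  (cops (move 0549 ∷ move 0605 ∷ move 2706 ∷ move 4506 ∷ move 4945 ∷ move 7945 ∷ move 2794 ∷
         move 7949 ∷ move 2797 ∷ []) 27)

L43 : Lemma
L43 = lemma 102030404365747687929598 2150517581869697
  (query 63 (query 82 (cops (move 0839 ∷ move 3839 ∷ move 0708 ∷ move 0738 ∷ []) 07) $
             use L22 0123498765) $
   use L42 0123456789)

L44 : Lemma
L44 = lemma 1020304043657687929598 215060708090
  (query 81 (use L41 0123456789) $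
   query 75 (use L33 0213467895) $
   query 96 (use L34 0123487659) $
   query 86 (use L33 0213476598) $
   query 97 (use L34 0123456789) $
   query 51 (use L41 0123487659) $
   query 74 (use L43 0123456789) $
   query 64 (use L43 0123487659) $
   query 73 (use L42 0124356789) $
   query 63 (use L42 0124387659) $
   query 71 (use L36 0123476598) $
   cops (move 2509 ∷ move 2505 ∷ move 2909 ∷ move 2905 ∷ move 5969 ∷ move 5952 ∷ move 5992 ∷ []) 59)

-- The pentagon 5-6-7-8-9 outside the star, with an edge between two neighbours of 0. The five uses
-- of `L21` treat its five diagonals, which its symmetries permute.
L45 : Lemma
L45 = lemma 10203040436576879598 5060708090
  (query 21 (query 97 (use L21 0123456789) $
             query 86 (use L21 0123459876) $
             query 85 (use L21 0123467895) $
             query 96 (use L21 0123478956) $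
             query 75 (use L21 0123498765) $
             query 94 (use L25 0123456789) $
             query 84 (use L25 0123476598) $
             query 93 (use L25 0124356789) $
             query 83 (use L25 0124376598) $
             use L27 0123456789) $
   query 82 (use L44 0123476598) $
   query 72 (use L44 0123465987) $
   query 52 (use L44 0123467895) $
   query 81 (use L44 0213476598) $
   query 71 (use L44 0213465987) $
   query 51 (use L44 0213467895) $
   query 97 (use L20 0341265897) $
   query 86 (use L20 0341265798) $
   use L27 0341295678)

L46 : Lemma
L46 = lemma 2030536465727681879295 21414360849091
  (cops (move 2526 ∷ move 5762 ∷ move 3752 ∷ move 3757 ∷ move 3837 ∷ move 5837 ∷ move 3858 ∷ []) 38)

L47 : Lemma
L47 = lemma 103040536465727683879598 21313241425070809092
  (query 51 (cops (move 3637 ∷ move 5637 ∷ move 4563 ∷ move 5654 ∷ move 5756 ∷ move 3657 ∷ move 6857 ∷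
                   move 3686 ∷ []) 36) $
   query 91 (use L46 0134267895) $
   cops (move 3607 ∷ move 3686 ∷ move 3707 ∷ move 3736 ∷ move 7863 ∷ move 6873 ∷ move 7873 ∷
         move 6778 ∷ move 6768 ∷ []) 67)

L48 : Lemma
L48 = lemma 10203040646572768387949598 2131324142435060708090
  (query 53 (query 92 (query 91 (use star₅ 9124586703) $
                       query 81 (query 84 (use star₅ 8134796025) $
                                 use L46 0123456789) $
                       cops (move 2506 ∷ move 3952 ∷ move 5952 ∷ move 5939 ∷ move 6959 ∷ move 2596 ∷ move 5796 ∷
                             move 2575 ∷ []) 25) $
             use L47 0123456789) $
   use L47 0134267895)

L49 : Lemma
L49 = lemma 1020406572768394959698 313243506081
  (cops (move 2906 ∷ move 2829 ∷ move 7829 ∷ move 7929 ∷ move 7828 ∷ move 7928 ∷ move 6879 ∷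
         move 6878 ∷ []) 68)

L50 : Lemma
L50 = lemma 10203065727476839598 313241435060819091
  (cops (move 2506 ∷ move 3706 ∷ move 2925 ∷ move 6873 ∷ move 7873 ∷ move 7925 ∷ move 7968 ∷
         move 2979 ∷ move 7879 ∷ move 2978 ∷ []) 29)

L51 : Lemma
L51 = lemma 102030406572768387949598 2131324142435060708090
  (query 64 (use L48 0123456789) $
   query 52 (use L48 0134267895) $
   query 81 (cops (move 2829 ∷ move 7829 ∷ move 7828 ∷ move 7928 ∷ move 6879 ∷ move 6878 ∷ []) 68) $
   query 75 (use L49 0143265987) $
   query 91 (query 63 (cops (move 1617 ∷ move 6971 ∷ move 1696 ∷ move 3969 ∷ move 1693 ∷ []) 16) $
             use L36 0213476598) $
   query 74 (use L50 0123456789) $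
   cops (move 2506 ∷ move 2509 ∷ move 2809 ∷ move 2909 ∷ move 3506 ∷ move 3509 ∷ move 3606 ∷
         move 2925 ∷ move 3635 ∷ move 6853 ∷ move 6863 ∷ move 7863 ∷ move 7868 ∷ move 2978 ∷
         move 2829 ∷ move 7828 ∷ move 3687 ∷ move 6878 ∷ move 3686 ∷ []) 36)

L52 : Lemma
L52 = lemma 1020304065768387949598 2131324142435060708090
  (query 72 (use L51 0123456789) $
   query 52 (use L51 0124376598) $
   query 71 (use L51 0213456789) $
   query 96 (use L3 0341257689) $
   query 51 (use L51 0214376598) $
   query 53 (query 62 (use L51 0123487659) $
             query 91 (use L50 0213478956) $
             cops (move 3707 ∷ move 3708 ∷ move 3807 ∷ move 3808 ∷ move 4807 ∷ move 4808 ∷ move 7873 ∷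
                   move 7984 ∷ move 8984 ∷ move 6879 ∷ move 7879 ∷ move 7868 ∷ move 3887 ∷ move 8978 ∷
                   move 3889 ∷ []) 38) $
   use L40 0412376598)

L53 : Lemma
L53 = lemma 10203040657687949598 2131324142435060708090
  (query 83 (use L52 0123456789) $
   query 53 (use L52 0123487659) $
   query 82 (use L52 0132456789) $
   query 81 (use L52 0231456789) $
   query 97 (query 52 (use L52 0132487659) $
             query 91 (use star₅ 9145786023) $
             cops (move 4607 ∷ move 4606 ∷ move 4707 ∷ move 4706 ∷ move 6964 ∷ move 6974 ∷ []) 69) $
   use L40 0412367895)

L54 : Lemma
L54 = lemma 1020304075768794 919293
  (cops (move 0747 ∷ []) 07)

L55 : Lemma
L55 = lemma 1020304075768794959698 0
  (query 93 (use star₅ 9345680712) $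
   query 92 (use star₅ 9245680713) $
   query 91 (use star₅ 9145680723) $
   use L54 0123456789)

L56 : Lemma
L56 = lemma 10203040768794959698 6575
  (query 93 (use star₅ 9345680712) $
   query 92 (use star₅ 9245680713) $
   query 91 (use star₅ 9145680723) $
   cops (move 0809 ∷ move 0708 ∷ move 4708 ∷ move 0747 ∷ []) 07)

L57 : Lemma
L57 = lemma 10203040768487959698 6571759293
  (cops (move 0809 ∷ move 4609 ∷ move 0708 ∷ move 0746 ∷ []) 07)

L58 : Lemma
L58 = lemma 102030407687959698 657090
  (query 75 (query 73 (use L55 0124356987) $
             query 71 (use L55 0234156987) $
             query 74 (use L55 0123456987) $
             query 72 (use L55 0134256987) $
             use L19 0123457689) $
   query 94 (use L56 0123456789) $
   query 93 (use L56 0124356789) $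
   query 92 (use L56 0134256789) $
   query 71 (cops (move 0809 ∷ move 1809 ∷ move 0708 ∷ move 1708 ∷ move 1707 ∷ move 1807 ∷ move 7817 ∷
                   move 7818 ∷ []) 78) $
   query 84 (use L57 0123456789) $
   query 83 (use L57 0124356789) $
   query 72 (cops (move 0609 ∷ move 2909 ∷ move 0629 ∷ []) 06) $
   query 74 (cops (move 0609 ∷ move 4909 ∷ move 0649 ∷ []) 06) $
   query 73 (use L54 0124356987) $
   use L19 0123457689)

L59 : Lemma
L59 = lemma 1020304076879598 657090
  (query 96 (use L58 0123456789) $
   query 75 (use L58 0123465987) $
   cops (move 0807 ∷ move 0809 ∷ []) 08)

-- The edge 65 closes the path 6-7-8-9-5 to a pentagon. Edges among the neighbours of 0 go to `L45`,
-- edges from these to 8 or 9 to `L53`; without any, `L26` lets a cop on 6 shut the robber in {8,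
-- 9}.
L60 : Lemma
L60 = lemma 1020304076879598 5060708090
  (query 65 (query 43 (use L45 0123456789) $
             query 42 (use L45 0132456789) $
             query 32 (use L45 0142356789) $
             query 41 (use L45 0231456789) $
             query 31 (use L45 0241356789) $
             query 21 (use L45 0341256789) $
             query 94 (use L53 0123456789) $
             query 84 (use L53 0123476598) $
             query 93 (use L53 0124356789) $
             query 83 (use L53 0124376598) $
             query 92 (use L53 0134256789) $
             query 82 (use L53 0134276598) $
             query 91 (use L53 0234156789) $
             query 81 (use L53 0234176598) $
             use L26 0123456789) $
   use L59 0123456789)

L61 : Lemma
L61 = lemma 30407691929598 606364707374
  (cops (walk 906 76 ∷ []) 09)

L62 : Lemma
L62 = lemma 10203040769598 5060708090
  (query 87 (use L60 0123456789) $
   query 86 (use L60 0123457689) $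
   query 75 (use L59 0123486759) $
   query 65 (use L59 0123487659) $
   query 97 (use L2 9715826340) $
   query 96 (use L2 9615827340) $
   use L61 9125836740)

L63 : Lemma
L63 = lemma 1020304063768692949798 657075808595
  (query 61 (query 43 (query 62 (use star₅ 6123780459) $
                       cops (move 1469 ∷ walk 095 5 ∷ move 0914 ∷ []) 09) $
             cops (move 1969 ∷ move 2696 ∷ walk 015 5 ∷ walk 025 5 ∷ move 1902 ∷ move 2601 ∷ move 1962 ∷ []) 19) $
   cops (move 0939 ∷ walk 095 5 ∷ []) 09)

L64 : Lemma
L64 = lemma 10203040637686949798 657075808595
  (query 92 (use L63 0123456789) $
   query 91 (use L63 0213456789) $
   cops (move 0646 ∷ walk 065 5 ∷ []) 06)

L65 : Lemma
L65 = lemma 102030407686949798 657075808595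
  (query 63 (use L64 0123456789) $
   query 62 (use L64 0132456789) $
   query 81 (cops (walk 095 5 ∷ move 1909 ∷ move 4809 ∷ move 8919 ∷ move 8984 ∷ []) 89) $
   cops (walk 075 5 ∷ walk 095 5 ∷ move 4709 ∷ move 4707 ∷ move 4909 ∷ move 4907 ∷ move 7974 ∷
         move 7994 ∷ []) 79)

L66 : Lemma
L66 = lemma 10203040769798 65707580859095
  (query 86 (query 94 (use L65 0123456789) $
             query 92 (use L65 0134256789) $
             query 93 (use L65 0124356789) $
             query 91 (use L65 0234156789) $
             cops (walk 065 5 ∷ walk 609 9 ∷ []) 06) $
   cops (move 0709 ∷ walk 075 5 ∷ []) 07)

L67 : Lemma
L67 = lemma 102030407698 5060708090
  (query 95 (use L62 0123456789) $
   query 85 (use L62 0123456798) $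
   query 75 (use L62 0123458967) $
   query 65 (use L62 0123458976) $
   query 97 (use L66 0123456789) $
   query 86 (use L66 0123457698) $
   query 87 (use L66 0123456798) $
   query 96 (use L66 0123457689) $
   cops (walk 056 76 ∷ walk 058 98 ∷ []) 05)

L68 : Lemma
L68 = lemma 10203040969798 6575
  (query 95 (cops [] 09) $
   use L3 9816725340)

L69 : Lemma
L69 = lemma 102030409798 5060657075768090
  (query 86 (use L67 0123456879) $
   query 85 (use L67 0123465879) $
   query 96 (use L68 0123456789) $
   query 95 (use L68 0123465789) $
   cops (walk 056 6 ∷ walk 059 987 ∷ []) 05)

L70 : Lemma
L70 = lemma 1020304098 5060708090
  (query 76 (use L67 0123456789) $
   query 75 (use L67 0123465789) $
   query 65 (use L67 0123475689) $
   query 97 (use L69 0123456789) $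
   query 87 (use L69 0123456798) $
   query 96 (use L69 0123457689) $
   query 86 (use L69 0123457698) $
   query 95 (use L69 0123467589) $
   query 85 (use L69 0123467598) $
   cops (walk 056 6 ∷ walk 057 7 ∷ walk 058 98 ∷ []) 05)

-- A fifth neighbour of 0 falls to `star₅`, so after five queries 0 has degree exactly four and the
-- ten pairs outside are alike under relabelling.
star₄ : Lemma
star₄ = lemma 10203040 0
  (query 90 (use star₅ 0123496785) $
   query 80 (use star₅ 0123486759) $
   query 70 (use star₅ 0123476589) $
   query 60 (use star₅ 0123465789) $
   query 50 (use star₅ 0123456789) $
   query 98 (use L70 0123456789) $
   query 97 (use L70 0123456879) $
   query 87 (use L70 0123456978) $
   query 96 (use L70 0123457869) $
   query 95 (use L70 0123467859) $
   query 86 (use L70 0123457968) $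
   query 85 (use L70 0123467958) $
   query 76 (use L70 0123458967) $
   query 75 (use L70 0123468957) $
   query 65 (use L70 0123478956) $
   cops (walk 056 6 ∷ walk 057 7 ∷ walk 058 8 ∷ walk 059 9 ∷ []) 05)

-- A vertex of degree three

L71 : Lemma
L71 = lemma 10203042547686949798 65758590
  (query 64 (use star₄ 4256901783) $
   query 84 (use star₄ 4258906713) $
   query 93 (use star₄ 9347856012) $
   query 91 (use star₄ 9147856023) $
   cops (move 0904 ∷ move 2646 ∷ move 0709 ∷ move 0607 ∷ move 2607 ∷ move 0626 ∷ []) 06)

L72 : Lemma
L72 = lemma 1020305153547686939798 5264657484859294
  (query 91 (use star₄ 9137856024) $
   cops (move 0305 ∷ move 0636 ∷ move 0706 ∷ move 0903 ∷ move 1903 ∷ move 0907 ∷ move 0919 ∷ []) 09)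

L73 : Lemma
L73 = lemma 102030547686 646574758485909192939495
  (cops (walk 064 54 ∷ walk 609 9 ∷ []) 06)

L74 : Lemma
L74 = lemma 1020304251535476869798 4060708090
  (query 52 (use star₄ 5123406789) $
   query 95 (use star₄ 5134906782) $
   query 85 (use star₄ 5134806729) $
   query 75 (use star₄ 5134706289) $
   query 65 (use star₄ 5134602789) $
   query 94 (use L71 0123456789) $
   query 64 (use L71 0123459786) $
   query 92 (use L71 5143206789) $
   query 62 (use L71 5143209786) $
   query 84 (use L71 0123457698) $
   query 74 (use L71 0123458697) $
   query 82 (use L71 5143207698) $
   query 72 (use L71 5143208697) $
   query 93 (use L72 0123456789) $
   query 91 (use L72 5341206879) $
   use L73 0123456789)

L75 : Lemma
L75 = lemma 10203042535476838691 314151607092939495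
  (query 73 (use star₄ 3057816249) $
   cops (move 0616 ∷ move 2606 ∷ move 2806 ∷ move 4626 ∷ move 4826 ∷ move 2846 ∷ move 4846 ∷
         move 3482 ∷ move 3484 ∷ []) 34)

L76 : Lemma
L76 = lemma 1020304253547686919798 4151607080
  (query 93 (use star₄ 9137856024) $
   query 92 (use star₄ 9127856034) $
   query 95 (use star₄ 9157806234) $
   query 94 (use star₄ 9147856023) $
   query 63 (cops (move 0616 ∷ move 2606 ∷ move 3462 ∷ move 4626 ∷ move 3464 ∷ []) 34) $
   query 31 (query 32 (use star₄ 3012546789) $
             query 81 (use star₄ 1038956724) $
             cops (move 2707 ∷ move 3616 ∷ move 4941 ∷ move 5941 ∷ move 4959 ∷ move 5636 ∷ move 2749 ∷
                   move 4749 ∷ move 4727 ∷ move 4647 ∷ move 5647 ∷ move 4656 ∷ []) 46) $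
   query 83 (use L75 0123456789) $
   query 73 (use L75 0123456879) $
   cops (move 0616 ∷ move 1404 ∷ move 2606 ∷ move 4941 ∷ move 4626 ∷ move 4849 ∷ move 4826 ∷
         move 4648 ∷ []) 46)

L77 : Lemma
L77 = lemma 1020304243535476869798 41516061707180819091
  (query 93 (use star₄ 3045916782) $
   query 83 (use star₄ 3045816729) $
   query 94 (use star₄ 4235906781) $
   query 84 (use star₄ 4235806719) $
   query 74 (use star₄ 4235706189) $
   query 65 (use L71 0132549786) $
   query 82 (cops (move 2608 ∷ move 2808 ∷ move 3808 ∷ move 2483 ∷ move 4838 ∷ move 4842 ∷ move 4648 ∷
                   move 4948 ∷ move 2646 ∷ move 2746 ∷ move 2749 ∷ move 2846 ∷ move 2627 ∷ move 6872 ∷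
                   move 6882 ∷ move 2686 ∷ []) 26) $
   query 85 (cops (move 2505 ∷ move 4825 ∷ move 4948 ∷ move 4749 ∷ move 5749 ∷ move 4757 ∷ []) 47) $
   use L73 4235017698)

L78 : Lemma
L78 = lemma 10203053547686949798 4151526062808183
  (cops (move 3707 ∷ move 3709 ∷ move 3907 ∷ move 3909 ∷ move 5739 ∷ move 5737 ∷ move 5939 ∷
         move 5937 ∷ move 4657 ∷ move 4757 ∷ move 4759 ∷ move 4957 ∷ move 4959 ∷ move 7974 ∷
         move 7964 ∷ move 7994 ∷ []) 79)

L79 : Lemma
L79 = lemma 103042547686 606163707173808183909192939495
  (cops (walk 460 310 ∷ walk 649 9 ∷ []) 46)

L80 : Lemma
L80 = lemma 1020304253547686939798 3241516061708081
  (query 83 (use star₄ 3058916724) $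
   query 92 (use star₄ 9237856014) $
   query 94 (use star₄ 9347856012) $
   cops (move 2309 ∷ move 2909 ∷ move 4923 ∷ move 4929 ∷ move 4749 ∷ move 5749 ∷ move 4757 ∷
         move 4647 ∷ move 5647 ∷ move 5646 ∷ move 5746 ∷ move 3656 ∷ move 3657 ∷ []) 36)

L81 : Lemma
L81 = lemma 10204253546576869798 326270718081909193
  (cops (move 2505 ∷ move 4525 ∷ move 4625 ∷ move 5645 ∷ move 4656 ∷ move 4746 ∷ move 4947 ∷
         move 5947 ∷ move 4959 ∷ []) 49)

L82 : Lemma
L82 = lemma 10203042537684869798 4143515275909193
  (cops (move 0638 ∷ move 0838 ∷ move 2606 ∷ move 2608 ∷ move 2806 ∷ move 2808 ∷ move 4626 ∷
         move 4628 ∷ move 4726 ∷ move 4826 ∷ move 4828 ∷ move 6864 ∷ move 6874 ∷ move 6884 ∷ []) 68)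

L83 : Lemma
L83 = lemma 10204253547686959798 326061627071808184
  (cops (move 2505 ∷ move 4525 ∷ move 4925 ∷ move 5945 ∷ move 5949 ∷ move 5759 ∷ move 7995 ∷
         move 5657 ∷ move 7975 ∷ move 5697 ∷ []) 56)

L84 : Lemma
L84 = lemma 10203042535476869798 405060708090
  (query 51 (use L74 0123456789) $
   query 41 (use L74 0132546789) $
   query 91 (use L76 0123456789) $
   query 81 (use L76 0123457698) $
   query 71 (use L76 0123458697) $
   query 61 (use L76 0123459786) $
   query 43 (use L77 0123456789) $
   query 52 (use L77 0132546789) $
   query 32 (query 93 (use star₄ 3025916784) $
             query 62 (use star₄ 2034651789) $
             query 63 (use star₄ 3025614789) $
             query 92 (use star₄ 2034956781) $
             query 83 (use star₄ 3025816749) $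
             query 73 (use star₄ 3025716489) $
             query 95 (cops (move 2707 ∷ move 2709 ∷ move 2907 ∷ move 2909 ∷ move 4729 ∷ move 4727 ∷ move 4647 ∷
                             move 5647 ∷ move 4656 ∷ []) 46) $
             query 94 (use L78 0123456789) $
             use L79 0123456789) $
   query 93 (use L80 0123456789) $
   query 62 (use L80 0132549876) $
   query 65 (use L81 0123456789) $
   query 94 (use L81 0132549786) $
   query 83 (use L80 0123457968) $
   query 75 (use L78 0132548967) $
   query 84 (use L82 0123456789) $
   query 95 (use L83 0123456789) $
   query 92 (use L80 0132546879) $
   query 74 (use L83 0132548967) $
   query 85 (use L82 0132549786) $
   query 64 (use L71 0123459786) $
   use L73 0123456789)

L85 : Lemma
L85 = lemma 102030535476858697 404142909192
  (query 75 (use star₄ 5347806129) $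
   cops (move 3657 ∷ move 0636 ∷ move 0836 ∷ move 0608 ∷ []) 06)

L86 : Lemma
L86 = lemma 102042435476869198 31415160708092939495
  (cops (move 0616 ∷ move 4941 ∷ move 2606 ∷ move 4849 ∷ move 4626 ∷ move 4826 ∷ move 4648 ∷ []) 46)

L87 : Lemma
L87 = lemma 10203053547686949798 404142708090
  (query 92 (use star₄ 9247856013) $
   query 91 (use star₄ 9147856023) $
   query 93 (use star₄ 9347856012) $
   query 65 (cops (move 3506 ∷ move 3606 ∷ move 5636 ∷ move 5635 ∷ move 4756 ∷ move 6756 ∷ move 5967 ∷
                   move 5947 ∷ []) 59) $
   query 85 (use L85 0123456789) $
   query 75 (use L85 0123456879) $
   use L86 5431026879)

L88 : Lemma
L88 = lemma 10203053547686929798 404142657585939495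
  (query 91 (use star₄ 9127856034) $
   cops (move 0626 ∷ move 3656 ∷ move 3856 ∷ move 0636 ∷ move 0836 ∷ move 0806 ∷ move 3806 ∷
         move 0908 ∷ move 0938 ∷ move 3908 ∷ move 3938 ∷ move 0209 ∷ move 0239 ∷ move 2390 ∷
         move 2393 ∷ move 0320 ∷ move 0323 ∷ []) 03)

L89 : Lemma
L89 = lemma 102030535476869798 405060708090
  (query 42 (use L84 0123456789) $
   query 41 (use L84 0213456789) $
   query 94 (use L87 0123456789) $
   query 84 (use L87 0123457698) $
   query 74 (use L87 0123458697) $
   query 64 (use L87 0123459786) $
   query 95 (use L71 0132546789) $
   query 65 (use L71 0132549786) $
   query 85 (use L71 0132547698) $
   query 75 (use L71 0132548697) $
   query 93 (query 92 (use star₄ 9237856014) $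
             query 91 (use star₄ 9137856024) $
             cops (move 3656 ∷ move 3856 ∷ move 0636 ∷ move 0836 ∷ move 0806 ∷ move 3806 ∷ move 0908 ∷
                   move 0938 ∷ move 3908 ∷ move 3938 ∷ move 0309 ∷ move 0339 ∷ []) 03) $
   query 92 (use L88 0123456789) $
   query 91 (use L88 0213456789) $
   use L73 0123456789)

L90 : Lemma
L90 = lemma 102030547686939798 4041424350515253
  (query 92 (use star₄ 9237856014) $
   query 91 (use star₄ 9137856024) $
   query 95 (use star₄ 9357806124) $
   query 94 (use star₄ 9347856012) $
   cops (move 0636 ∷ walk 604 54 ∷ []) 06)

L91 : Lemma
L91 = lemma 1020305476869597 404142435051525380818283
  (cops (move 4756 ∷ walk 740 3210 ∷ []) 47)

-- Guarding from the centre is given up in the last branch: cops on 6 and 7 guard 6, 7, 8, 9, and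
-- the robber is shut in {4, 5} by the cop on 6 or in {0, 1, 2, 3} by the cop on 7.
L92 : Lemma
L92 = lemma 10203054768697 404142435051525380818283
  (query 95 (use L91 0123456789) $
   query 94 (use L91 0123546789) $
   cops (walk 674 54 ∷ walk 760 3210 ∷ []) 67)

L93 : Lemma
L93 = lemma 1020305476869798 405060708090
  (query 53 (use L89 0123456789) $
   query 43 (use L89 0123546789) $
   query 52 (use L89 0132456789) $
   query 42 (use L89 0132546789) $
   query 51 (use L89 0231456789) $
   query 41 (use L89 0231546789) $
   query 81 (use L90 0231457698) $
   query 82 (use L90 0132457698) $
   query 83 (use L90 0123457698) $
   use L92 0123456789)

L94 : Lemma
L94 = lemma 1020305464768587919798 70809293
  (query 83 (use star₄ 8357906124) $
   query 73 (use star₄ 7368950124) $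
   query 82 (use star₄ 8257906134) $
   query 72 (use star₄ 7268950134) $
   cops (move 1404 ∷ move 1494 ∷ []) 14)

L95 : Lemma
L95 = lemma 102030546476818598 75868790929395
  (cops (move 1486 ∷ move 1686 ∷ move 0416 ∷ move 0616 ∷ move 0406 ∷ move 1406 ∷ move 0504 ∷
         move 0514 ∷ []) 05)

L96 : Lemma
L96 = lemma 1020305464768485919798 7580879495
  (query 83 (use star₄ 8345906712) $
   query 82 (use star₄ 8245906713) $
   use L95 0123674598)

L97 : Lemma
L97 = lemma 10203032535464769798 758184869495
  (cops (move 0739 ∷ move 3739 ∷ move 0607 ∷ move 0637 ∷ move 3607 ∷ move 3637 ∷ move 0406 ∷
         move 0436 ∷ []) 04)

L98 : Lemma
L98 = lemma 1020303254636476919798 5052538494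
  (cops (move 1694 ∷ move 6949 ∷ move 3969 ∷ move 0739 ∷ move 1693 ∷ move 0616 ∷ move 0716 ∷
         move 0607 ∷ []) 06)

L99 : Lemma
L99 = lemma 1020303243546476919798 50527581869495
  (cops (move 3749 ∷ move 3949 ∷ move 0739 ∷ move 1493 ∷ move 3739 ∷ move 0607 ∷ move 0614 ∷
         move 0637 ∷ []) 06)

L100 : Lemma
L100 = lemma 20305464919798 404243505253606263
  (cops (walk 904 654 ∷ []) 09)

L101 : Lemma
L101 = lemma 1020303254647685919798 405060707580869094
  (query 93 (use star₄ 9137856024) $
   query 92 (use star₄ 9127856034) $
   query 96 (use star₄ 9167850234) $
   query 95 (use star₄ 9157806234) $
   query 87 (use L94 0123456789) $
   query 81 (use L95 0123456789) $
   query 71 (use L95 0123465879) $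
   query 84 (use L96 0123456789) $
   query 53 (use L97 0123456789) $
   query 52 (use L97 0132456789) $
   query 63 (use L98 0123456789) $
   query 62 (use L98 0132456789) $
   query 43 (use L99 0123456789) $
   query 42 (use L99 0132465879) $
   use L100 0123456789)

L102 : Lemma
L102 = lemma 10203032546476939798 717580818291
  (cops (move 3404 ∷ move 3494 ∷ move 3694 ∷ move 3436 ∷ []) 34)

L103 : Lemma
L103 = lemma 1020303254647685939798 5051717580819194
  (query 82 (query 53 (use star₄ 3025916784) $
             use L102 0132647958) $
   use L102 0123456789)

L104 : Lemma
L104 = lemma 1020305464768597 70718081828390919293
  (query 73 (use L85 0123974568) $
   query 72 (use L85 0132974568) $
   use L92 0123795486)

L105 : Lemma
L105 = lemma 10203032546476859798 405060707580869094
  (query 91 (use L101 0123456789) $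
   query 81 (use L101 0123674598) $
   query 71 (use L101 0123584697) $
   query 61 (use L101 0123895476) $
   query 51 (use L101 0123796485) $
   query 93 (use L103 0123456789) $
   query 92 (use L103 0132465879) $
   query 83 (use L102 0123674598) $
   query 82 (use L102 0132674598) $
   use L104 0123456789)

L106 : Lemma
L106 = lemma 10203054636476828598 3140758687909195
  (cops (move 2686 ∷ move 0426 ∷ move 0626 ∷ move 0406 ∷ move 2406 ∷ move 0504 ∷ move 2405 ∷
         move 3805 ∷ move 2624 ∷ move 6842 ∷ move 3862 ∷ move 3868 ∷ []) 38)

L107 : Lemma
L107 = lemma 1020305463647685939798 313240758086879091929495
  (query 82 (use L106 0123456789) $
   query 81 (use L106 0213456789) $
   use L95 0312674598)

L108 : Lemma
L108 = lemma 10203043546476828598 707173869091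
  (cops (move 4868 ∷ move 2484 ∷ move 0424 ∷ move 0524 ∷ move 0405 ∷ []) 04)

-- The hexagon 4-5-8-9-7-6 lies outside the star, and 3 meets its opposite vertices 4 and 9. The
-- first three queries ask that 1 meet 5 and 7, and 2 meet 6 and 8; one more edge would give 1 or 2
-- a fourth neighbour, and otherwise the graph is the Petersen graph.
L109 : Lemma
L109 = lemma 102030435464768285939798 2131324041425053606365707374758083848687909192949596
  (query 71 (query 62 (query 51 (query 72 (use star₄ 2067851349) $
                                 query 52 (use star₄ 2056813749) $
                                 query 81 (use star₄ 1057826349) $
                                 query 61 (use star₄ 1056723489) $
                                 use petersen 0965487123) $
                       use L108 0123978564) $
             use L50 7619243085) $
   use L108 0123456789)

L110 : Lemma
L110 = lemma 102030546476828597 435375838687919495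
  (cops (move 2607 ∷ move 2707 ∷ move 0627 ∷ move 2627 ∷ move 0406 ∷ move 0426 ∷ move 2406 ∷
         move 2426 ∷ move 0504 ∷ move 0524 ∷ []) 05)

L111 : Lemma
L111 = lemma 10203054647685939798 213132405060707580869094
  (query 92 (use star₄ 9237856014) $
   query 91 (use star₄ 9137856024) $
   query 87 (use L94 0312456789) $
   query 96 (use star₄ 9367850124) $
   query 73 (use L95 0312465879) $
   query 74 (use L96 0312465879) $
   query 95 (use star₄ 9357806124) $
   query 83 (use L95 0312456789) $
   query 84 (use L96 0312456789) $
   query 65 (query 82 (use L96 0213647958) $
             query 71 (use L96 0123548967) $
             cops (move 3505 ∷ move 3506 ∷ move 3605 ∷ move 3606 ∷ move 6953 ∷ move 6963 ∷ []) 69) $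
   query 63 (use L107 0123456789) $
   query 53 (use L107 0123465879) $
   query 43 (query 42 (use star₄ 4235601789) $
             query 41 (use star₄ 4135602789) $
             query 82 (use L109 0123456789) $
             query 81 (use L109 0213456789) $
             use L95 0312674598) $
   query 82 (use L110 0123456789) $
   query 81 (use L110 0213456789) $
   use L95 0312674598)

L112 : Lemma
L112 = lemma 102030546476859798 4050607080869094
  (query 75 (use L93 0123894567) $
   query 32 (use L105 0123456789) $
   query 31 (use L105 0213456789) $
   query 21 (use L105 0312456789) $
   query 93 (use L111 0123456789) $
   query 83 (use L111 0123674598) $
   query 73 (use L111 0123584697) $
   query 92 (use L111 0132456789) $
   query 91 (use L111 0231456789) $
   query 82 (use L111 0132674598) $
   query 81 (use L111 0231674598) $
   use L104 0312456789)

L113 : Lemma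
L113 = lemma 10203054657681859798 5052536474869495
  (cops (move 0805 ∷ move 1605 ∷ move 1805 ∷ move 0716 ∷ move 0908 ∷ move 1716 ∷ move 1908 ∷
         move 0907 ∷ move 1907 ∷ move 1709 ∷ move 1809 ∷ move 1909 ∷ move 8919 ∷ move 8917 ∷
         move 8918 ∷ []) 89)

L114 : Lemma
L114 = lemma 102030546576859397 748081829495
  (cops (move 0605 ∷ move 3605 ∷ move 3695 ∷ move 0636 ∷ move 0736 ∷ move 0607 ∷ []) 06)

L115 : Lemma
L115 = lemma 102030546576859798 748081828384909495
  (query 93 (use L114 0123456789) $
   query 92 (use L114 0132456789) $
   query 91 (use L114 0231456789) $
   cops (move 0605 ∷ walk 608 98 ∷ []) 06)

L116 : Lemma
L116 = lemma 102030546576859798 405060647080869094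
  (query 74 (use L93 0123894576) $
   query 84 (use L112 0123458967) $
   query 53 (use star₄ 5346801729) $
   query 95 (use star₄ 5468901723) $
   query 52 (use star₄ 5246801739) $
   query 81 (use L113 0123456789) $
   query 51 (use star₄ 5146802739) $
   query 83 (use L113 0312456789) $
   query 82 (use L113 0213456789) $
   use L115 0123456789)

L117 : Lemma
L117 = lemma 10203054757685939798 646572869194
  (cops (move 0507 ∷ move 0805 ∷ move 0907 ∷ move 3507 ∷ move 0809 ∷ move 3505 ∷ move 0835 ∷ []) 08)

L118 : Lemma
L118 = lemma 10203054757685 64869091929396
  (cops (move 0507 ∷ walk 509 9 ∷ []) 05)

L119 : Lemma
L119 = lemma 1020305476859798 40506070808690
  (query 94 (use L93 0123674598) $
   query 64 (use L112 0123456789) $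
   query 65 (use L116 0123456789) $
   query 74 (use L116 0123674598) $
   query 75 (query 73 (use star₄ 7356901284) $
             query 72 (use star₄ 7256901384) $
             query 91 (cops (move 0805 ∷ move 0907 ∷ move 1507 ∷ move 0809 ∷ move 0815 ∷ []) 08) $
             query 93 (use L117 0123456789) $
             query 92 (use L117 0132456789) $
             query 96 (query 71 (use star₄ 7156902384) $
                       use L115 0123458976) $
             use L118 0123456789) $
   cops (move 0805 ∷ move 0907 ∷ move 0809 ∷ []) 08)

L120 : Lemma
L120 = lemma 1020304265768691 4143929394
  (cops (move 0616 ∷ move 0626 ∷ []) 06)

L121 : Lemma
L121 = lemma 1020305476959798 40506064657080848690
  (query 74 (use L119 0123678945) $
   use L120 9578610234)

L122 : Lemma
L122 = lemma 10203054769798 405060708090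
  (query 86 (use L93 0123456789) $
   query 85 (use L119 0123456789) $
   query 84 (use L119 0123546789) $
   query 65 (use L119 0123458967) $
   query 64 (use L119 0123548967) $
   query 95 (use L121 0123456789) $
   query 94 (use L121 0123546789) $
   query 75 (use L120 7596810234) $
   query 74 (use L120 7496810235) $
   cops (move 0709 ∷ walk 074 54 ∷ []) 07)

-- The twelve pairs joining two of the disjoint edges 54, 76, 98 are alike under relabelling. Apart
-- from the last four queries of the earlier lemma, none is examined twice: without them the robber
-- is confined to one of the three edges.
L123 : Lemma
L123 = lemma 102030547698 405060708090
  (query 97 (use L122 0123456789) $
   query 87 (use L122 0123456798) $
   query 96 (use L122 0123457689) $
   query 86 (use L122 0123457698) $
   query 95 (use L122 0123674589) $
   query 84 (use L122 0123675498) $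
   query 85 (use L122 0123674598) $
   query 94 (use L122 0123675489) $
   query 75 (use L122 0123894567) $
   query 64 (use L122 0123895476) $
   query 65 (use L122 0123894576) $
   query 74 (use L122 0123895467) $
   cops (walk 046 76 ∷ walk 048 98 ∷ []) 04)

L124 : Lemma
L124 = lemma 102030747683959698 547172758494
  (cops (move 0607 ∷ move 3607 ∷ move 0906 ∷ move 0936 ∷ []) 09)

L125 : Lemma
L125 = lemma 1020307476959698 405054607071727375808490
  (query 94 (use star₄ 9456801723) $
   query 83 (use L124 0123456789) $
   query 82 (use L124 0132456789) $
   query 81 (use L124 0231456789) $
   query 85 (use L123 0123475869) $
   cops (move 0607 ∷ move 0609 ∷ walk 608 8 ∷ []) 06)

L126 : Lemma
L126 = lemma 1020307476879598 40505460657080848690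
  (query 75 (use star₄ 7456801239) $
   query 73 (use star₄ 7346850129) $
   query 72 (use star₄ 7246850139) $
   query 71 (use star₄ 7146850239) $
   query 96 (use L125 0123456789) $
   query 94 (use L125 0123654789) $
   cops (move 0807 ∷ move 0809 ∷ []) 08)

L127 : Lemma
L127 = lemma 10203074769598 4050546070808490
  (query 86 (use L123 0123475968) $
   query 65 (use L123 0123475689) $
   query 97 (cops (move 0709 ∷ []) 07) $
   query 87 (use L126 0123456789) $
   query 96 (use L126 0123548967) $
   query 75 (use L126 0123486759) $
   query 94 (use L126 0123568947) $
   use L100 7146958230)

L128 : Lemma
L128 = lemma 10203054768797 6465747584859495
  (cops (walk 047 9876 ∷ []) 04)

L129 : Lemma
L129 = lemma 1020303265768387919598 5054647484869092939497
  (query 71 (query 52 (cops (move 2757 ∷ walk 014 4 ∷ move 0127 ∷ []) 01) $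
             query 63 (use star₄ 3026851749) $
             cops (walk 074 4 ∷ move 3707 ∷ move 7873 ∷ move 7978 ∷ move 8978 ∷ move 7989 ∷ []) 79) $
   cops (move 0536 ∷ move 3536 ∷ walk 094 4 ∷ move 0905 ∷ move 0935 ∷ []) 09)

L130 : Lemma
L130 = lemma 1020306576879198 52546474808384929394
  (cops (walk 064 4 ∷ walk 074 4 ∷ move 1606 ∷ move 1607 ∷ move 1706 ∷ move 1707 ∷ move 6961 ∷
         move 6971 ∷ []) 69)

L131 : Lemma
L131 = lemma 10203032657687919598 5054647480849094
  (query 93 (use star₄ 9135806724) $
   query 92 (use star₄ 9125806734) $
   query 86 (use L118 6578209134) $
   query 75 (use L118 7568209134) $
   query 97 (use star₄ 9157806234) $
   query 96 (use star₄ 9156802734) $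
   query 83 (use L129 0123456789) $
   query 52 (use L129 0132487659) $
   use L130 0123456789)

L132 : Lemma
L132 = lemma 1020303265769398 546474808182849194
  (cops (move 3696 ∷ walk 064 4 ∷ move 0636 ∷ []) 06)

L133 : Lemma
L133 = lemma 10203032657687939598 54647071748081849194
  (query 82 (query 63 (use star₄ 3026951784) $
             cops (walk 054 4 ∷ move 2505 ∷ move 5852 ∷ move 8925 ∷ move 5898 ∷ []) 58) $
   use L132 0123456789)

L134 : Lemma
L134 = lemma 102030657698 54647480818283849091929394
  (cops (walk 064 4 ∷ walk 608 98 ∷ []) 06)

L135 : Lemma
L135 = lemma 102030326576879598 50546064707480849094
  (query 91 (use L131 0123456789) $
   query 81 (use L131 0123476598) $
   query 71 (use L131 0123465987) $
   query 61 (use L131 0123459876) $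
   query 93 (use L133 0123456789) $
   query 83 (use L133 0123495678) $
   query 92 (use L132 0132456789) $
   query 82 (use L132 0132456798) $
   use L134 0123456789)

L136 : Lemma
L136 = lemma 102030657682879395 2132505154606474849194
  (cops (walk 074 4 ∷ move 3707 ∷ move 3807 ∷ move 7983 ∷ move 7973 ∷ move 8983 ∷ move 8973 ∷
         move 5897 ∷ move 5898 ∷ []) 58)

L137 : Lemma
L137 = lemma 102030657687939598 21313250546064707480849094
  (query 92 (use star₄ 9235806714) $
   query 91 (use star₄ 9135806724) $
   query 82 (query 51 (query 73 (cops (move 1757 ∷ walk 024 4 ∷ walk 034 4 ∷ move 1703 ∷ move 1802 ∷ move 1817 ∷ move 5817 ∷
                                       move 1858 ∷ []) 18) $
                       cops (move 2585 ∷ walk 014 4 ∷ walk 034 4 ∷ move 2501 ∷ move 2903 ∷ move 2925 ∷ move 8925 ∷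
                             move 5892 ∷ move 8929 ∷ move 5998 ∷ move 5958 ∷ []) 59) $
             use L136 0123456789) $
   query 51 (use L136 0213487659) $
   use L130 0321487659)

L138 : Lemma
L138 = lemma 1020306576879598 50546064707480849094
  (query 32 (use L135 0123456789) $
   query 31 (use L135 0213456789) $
   query 21 (use L135 0312456789) $
   query 93 (use L137 0123456789) $
   query 83 (use L137 0123476598) $
   query 92 (use L137 0132456789) $
   query 82 (use L137 0132476598) $
   query 91 (use L137 0231456789) $
   query 81 (use L137 0231476598) $
   use L134 0123456789)

L139 : Lemma
L139 = lemma 102030757687 546474849091929394
  (cops (walk 074 4 ∷ walk 709 9 ∷ []) 07)

L140 : Lemma
L140 = lemma 1020307376879598 54646574758490919294
  (cops (move 0809 ∷ move 3809 ∷ walk 074 4 ∷ move 0708 ∷ move 3708 ∷ move 3707 ∷ move 3807 ∷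
         move 7837 ∷ move 7838 ∷ []) 78)

L141 : Lemma
L141 = lemma 1020307687959698 5054606465707480849094
  (query 85 (use L138 0123458769) $
   query 93 (use star₄ 9356801724) $
   query 92 (use star₄ 9256801734) $
   query 91 (use star₄ 9156802734) $
   query 75 (use L139 0123456789) $
   query 73 (use L140 0123456789) $
   query 72 (use L140 0132458769) $
   query 71 (use L118 9568207134) $
   use L139 0123456987)

L142 : Lemma
L142 = lemma 10203076879598 50546064707480849094
  (query 65 (use L138 0123456789) $
   query 96 (use L141 0123456789) $
   query 75 (use L141 0123465987) $
   cops (move 0807 ∷ move 0809 ∷ walk 084 4 ∷ []) 08)

L143 : Lemma
L143 = lemma 10203076959798 54646574848694
  (cops (move 0709 ∷ walk 074 4 ∷ []) 07)

L144 : Lemma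
L144 = lemma 102030769598 40505460708090
  (query 84 (use L123 0123485967) $
   query 74 (use L127 0123456789) $
   query 64 (use L127 0123457689) $
   query 94 (query 97 (use star₄ 9457806123) $
             query 96 (use star₄ 9456801723) $
             query 87 (use L127 0123465987) $
             query 86 (use L127 0123475986) $
             query 75 (use L127 0123458967) $
             query 65 (use L127 0123458976) $
             use L128 0123674958) $
   query 87 (use L142 0123456789) $
   query 86 (use L142 0123457689) $
   query 75 (use L142 0123486759) $
   query 65 (use L142 0123487659) $
   query 97 (use L143 0123456789) $
   query 96 (use L143 0123457689) $
   cops (walk 049 985 ∷ walk 046 76 ∷ []) 04)

L145 : Lemma
L145 = lemma 1020307686939798 546465747584859495
  (query 92 (use star₄ 9237856014) $
   query 91 (use star₄ 9137856024) $
   cops (move 0636 ∷ walk 064 4 ∷ walk 065 5 ∷ []) 06)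

L146 : Lemma
L146 = lemma 102030769798 54646574758084859495
  (query 86 (query 81 (use L145 0231457698) $
             query 83 (use L145 0123457698) $
             query 82 (use L145 0132457698) $
             cops (walk 074 4 ∷ walk 075 5 ∷ walk 708 8 ∷ []) 07) $
   cops (move 0709 ∷ walk 074 4 ∷ walk 075 5 ∷ []) 07)

L147 : Lemma
L147 = lemma 1020307698 405060708090
  (query 54 (use L123 0123456789) $
   query 95 (use L144 0123456789) $
   query 85 (use L144 0123456798) $
   query 75 (use L144 0123458967) $
   query 65 (use L144 0123458976) $
   query 94 (use L144 0123546789) $
   query 84 (use L144 0123546798) $
   query 74 (use L144 0123548967) $
   query 64 (use L144 0123548976) $
   query 97 (use L146 0123456789) $
   query 86 (use L146 0123459876) $
   query 87 (use L146 0123459867) $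
   query 96 (use L146 0123458976) $
   cops (walk 045 5 ∷ walk 046 76 ∷ walk 048 98 ∷ []) 04)

L148 : Lemma
L148 = lemma 102030768797 546465747584859495
  (cops (walk 045 5 ∷ walk 047 9876 ∷ []) 04)

L149 : Lemma
L149 = lemma 102030969798 54646574758485
  (query 95 (use star₄ 9567801234) $
   query 94 (use star₄ 9467850123) $
   use L148 0123456978)

L150 : Lemma
L150 = lemma 1020309798 405054606465707475768090
  (query 86 (use L147 0123456879) $
   query 85 (use L147 0123465879) $
   query 84 (use L147 0123564879) $
   query 96 (use L149 0123456789) $
   query 95 (use L149 0123465789) $
   query 94 (use L149 0123564789) $
   cops (walk 045 5 ∷ walk 046 6 ∷ walk 049 987 ∷ []) 04)

L151 : Lemma
L151 = lemma 10203098 405060708090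
  (query 76 (use L147 0123456789) $
   query 75 (use L147 0123465789) $
   query 65 (use L147 0123475689) $
   query 74 (use L147 0123564789) $
   query 64 (use L147 0123574689) $
   query 54 (use L147 0123674589) $
   query 97 (use L150 0123456789) $
   query 87 (use L150 0123456798) $
   query 96 (use L150 0123457689) $
   query 86 (use L150 0123457698) $
   query 95 (use L150 0123467589) $
   query 85 (use L150 0123467598) $
   query 94 (use L150 0123567489) $
   query 84 (use L150 0123567498) $
   cops (walk 045 5 ∷ walk 046 6 ∷ walk 047 7 ∷ walk 048 98 ∷ []) 04)

star₃ : Lemma
star₃ = lemma 102030 0
  (query 90 (use star₄ 0123956784) $
   query 80 (use star₄ 0123856749) $
   query 70 (use star₄ 0123756489) $
   query 60 (use star₄ 0123654789) $
   query 50 (use star₄ 0123546789) $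
   query 40 (use star₄ 0123456789) $
   query 98 (use L151 0123456789) $
   query 97 (use L151 0123456879) $
   query 87 (use L151 0123456978) $
   query 96 (use L151 0123457869) $
   query 86 (use L151 0123457968) $
   query 76 (use L151 0123458967) $
   query 95 (use L151 0123467859) $
   query 94 (use L151 0123567849) $
   query 85 (use L151 0123467958) $
   query 84 (use L151 0123567948) $
   query 75 (use L151 0123468957) $
   query 74 (use L151 0123568947) $
   query 65 (use L151 0123478956) $
   query 64 (use L151 0123578946) $
   query 54 (use L151 0123678945) $
   cops (walk 045 5 ∷ walk 046 6 ∷ walk 047 7 ∷ walk 048 8 ∷ walk 049 9 ∷ []) 04)

-- A vertex of degree two: past `star₃` only paths and cycles are left

L152 : Lemma
L152 = lemma 10205463769398 747580818284859091929495
  (query 65 (use star₃ 6357401289) $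
   query 64 (use star₃ 6347051289) $
   query 53 (use star₃ 3569401782) $
   query 43 (use star₃ 3469051782) $
   cops (walk 064 54 ∷ walk 608 98 ∷ []) 06)

L153 : Lemma
L153 = lemma 102051546276879398 3032637073808485909296
  (cops (move 5652 ∷ move 5859 ∷ move 1758 ∷ move 5758 ∷ move 1657 ∷ move 5657 ∷ move 1656 ∷
         move 1756 ∷ move 0716 ∷ move 0717 ∷ []) 07)

L154 : Lemma
L154 = lemma 1020546276879398 304050637073747580818485909192949596
  (query 32 (use star₃ 2036451789) $
   query 51 (use L153 0123456789) $
   query 41 (use L153 0123546789) $
   query 31 (query 53 (use star₃ 3159406782) $
             query 43 (use star₃ 3149056782) $
             cops (move 0809 ∷ walk 604 54 ∷ move 0706 ∷ move 0708 ∷ []) 07) $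
   use L152 9382456710)

L155 : Lemma
L155 = lemma 10205476879398 304050607080909192949596
  (query 73 (use star₃ 7368450129) $
   query 85 (use star₃ 8579406123) $
   query 75 (use star₃ 7568401239) $
   query 84 (use star₃ 8479056123) $
   query 74 (use star₃ 7468051239) $
   query 82 (use star₃ 8279456013) $
   query 81 (use star₃ 8179456023) $
   query 72 (use star₃ 7268450139) $
   query 71 (use star₃ 7168450239) $
   query 63 (use L152 0123456789) $
   query 62 (use L154 0123456789) $
   query 61 (use L154 0213456789) $
   query 32 (use L154 0126453987) $
   query 31 (use L154 0216453987) $
   cops (move 4847 ∷ move 4849 ∷ walk 480 210 ∷ []) 48)

L156 : Lemma
L156 = lemma 102054769398 30405060708090
  (query 97 (use star₃ 9378456012) $
   query 96 (use star₃ 9368450712) $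
   query 95 (use star₃ 9358406712) $
   query 94 (use star₃ 9348056712) $
   query 92 (use star₃ 9238456701) $
   query 91 (use star₃ 9138456702) $
   query 87 (use L155 0123456789) $
   query 86 (use L155 0123457689) $
   query 85 (use L155 0123674589) $
   query 84 (use L155 0123675489) $
   query 73 (use L155 0128456739) $
   query 63 (use L155 0128457639) $
   query 53 (use L155 0128674539) $
   query 43 (use L155 0128675439) $
   query 72 (use L155 9381456720) $
   query 62 (use L155 9381457620) $
   query 71 (use L155 9382456710) $
   query 61 (use L155 9382457610) $
   cops (walk 049 983 ∷ walk 406 76 ∷ []) 04)

L157 : Lemma
L157 = lemma 10205476859798 435363646573747583869394
  (cops (move 0805 ∷ move 0907 ∷ walk 093 3 ∷ move 0809 ∷ []) 08)

L158 : Lemma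
L158 = lemma 10205476859798 4353637071727374758083869091929394
  (query 65 (use star₃ 5468012739) $
   query 64 (query 82 (use star₃ 8259406713) $
             query 81 (use star₃ 8159406723) $
             use L79 9758460123) $
   use L157 0123456789)

L159 : Lemma
L159 = lemma 102054769798 435363707380839093
  (query 95 (use star₃ 9578406123) $
   query 75 (use star₃ 7569401283) $
   query 94 (use star₃ 9478056123) $
   query 74 (use star₃ 7469051283) $
   query 92 (use star₃ 9278456013) $
   query 72 (use star₃ 7269450183) $
   query 91 (use star₃ 9178456023) $
   query 71 (use star₃ 7169450283) $
   query 86 (query 85 (use star₃ 8569401723) $
             query 84 (use star₃ 8469051723) $
             query 65 (use star₃ 6578401239) $
             query 64 (use star₃ 6478051239) $
             cops (walk 083 3 ∷ walk 084 54 ∷ walk 807 7 ∷ []) 08) $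
   query 85 (use L158 0123456789) $
   query 84 (use L158 0123546789) $
   query 65 (use L157 0123458967) $
   query 64 (use L157 0123548967) $
   cops (move 0709 ∷ walk 073 3 ∷ walk 074 54 ∷ []) 07)

L160 : Lemma
L160 = lemma 1020547698 30405060708090
  (query 93 (use L156 0123456789) $
   query 83 (use L156 0123456798) $
   query 73 (use L156 0123458967) $
   query 63 (use L156 0123458976) $
   query 53 (use L156 0123678945) $
   query 43 (use L156 0123678954) $
   query 97 (use L159 0123456789) $
   query 87 (use L159 0123456798) $
   query 96 (use L159 0123457689) $
   query 86 (use L159 0123457698) $
   query 95 (use L159 0123674589) $
   query 84 (use L159 0123675498) $
   query 85 (use L159 0123674598) $
   query 94 (use L159 0123675489) $
   query 75 (use L159 0123894567) $
   query 64 (use L159 0123895476) $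
   query 65 (use L159 0123894576) $
   query 74 (use L159 0123895467) $
   cops (walk 034 54 ∷ walk 036 76 ∷ walk 038 98 ∷ []) 03)

L161 : Lemma
L161 = lemma 1020768795 30404142435054607080849094
  (query 64 (use L160 0123465978) $
   query 74 (use star₃ 7468051239) $
   -- Vertex 4 is isolated in this branch.
   cut 987653210 04)

L162 : Lemma
L162 = lemma 1020769598 30404350535460708090
  (query 84 (use L160 0123485967) $
   query 83 (use L160 0124385967) $
   query 94 (use star₃ 9458016723) $
   query 93 (use star₃ 9358406712) $
   query 97 (use star₃ 9578406123) $
   query 96 (use star₃ 9568401723) $
   query 92 (use star₃ 9258406713) $
   query 91 (use star₃ 9158406723) $
   query 42 (use L160 9583012467) $
   query 41 (use L160 9583021467) $
   query 32 (use L160 9584012367) $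
   query 31 (use L160 9584021367) $
   query 87 (use L161 0123456789) $
   query 86 (use L161 0124357689) $
   query 75 (use L161 0124386759) $
   query 65 (use L161 0124387659) $
   cops (walk 069 985 ∷ walk 603 3 ∷ walk 604 4 ∷ []) 06)

L163 : Lemma
L163 = lemma 1020769798 43535463646573747583848590939495
  (query 86 (query 92 (use star₃ 9278456013) $
             query 91 (use star₃ 9178456023) $
             cops (walk 063 3 ∷ walk 064 4 ∷ walk 065 5 ∷ walk 609 9 ∷ []) 06) $
   cops (move 0709 ∷ walk 073 3 ∷ walk 074 4 ∷ walk 075 5 ∷ []) 07)

L164 : Lemma
L164 = lemma 10207698 30405060708090
  (query 54 (use L160 0123456789) $
   query 53 (use L160 0124356789) $
   query 43 (use L160 0125346789) $
   query 95 (use L162 0123456789) $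
   query 85 (use L162 0123456798) $
   query 75 (use L162 0123458967) $
   query 65 (use L162 0123458976) $
   query 94 (use L162 0123546789) $
   query 84 (use L162 0123546798) $
   query 74 (use L162 0123548967) $
   query 64 (use L162 0123548976) $
   query 93 (use L162 0124536789) $
   query 83 (use L162 0124536798) $
   query 73 (use L162 0124538967) $
   query 63 (use L162 0124538976) $
   query 97 (use L163 0123456789) $
   query 86 (use L163 0123459876) $
   query 87 (use L163 0123459867) $
   query 96 (use L163 0123458976) $
   cops (walk 034 4 ∷ walk 035 5 ∷ walk 036 76 ∷ walk 038 98 ∷ []) 03)

L165 : Lemma
L165 = lemma 10209798 3040435053546063646570737475768090
  (query 86 (use L164 0123456879) $
   query 96 (use star₃ 9678450123) $
   query 85 (use L164 0123465879) $
   query 95 (use star₃ 9578406123) $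
   query 84 (use L164 0123564879) $
   query 94 (use star₃ 9478056123) $
   query 83 (use L164 0124563879) $
   query 93 (use star₃ 9378456012) $
   cops (walk 034 4 ∷ walk 035 5 ∷ walk 036 6 ∷ walk 039 987 ∷ []) 03)

L166 : Lemma
L166 = lemma 102098 30405060708090
  (query 76 (use L164 0123456789) $
   query 75 (use L164 0123465789) $
   query 65 (use L164 0123475689) $
   query 74 (use L164 0123564789) $
   query 64 (use L164 0123574689) $
   query 54 (use L164 0123674589) $
   query 73 (use L164 0124563789) $
   query 63 (use L164 0124573689) $
   query 53 (use L164 0124673589) $
   query 43 (use L164 0125673489) $
   query 97 (use L165 0123456789) $
   query 87 (use L165 0123456798) $
   query 96 (use L165 0123457689) $
   query 86 (use L165 0123457698) $
   query 95 (use L165 0123467589) $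
   query 85 (use L165 0123467598) $
   query 94 (use L165 0123567489) $
   query 84 (use L165 0123567498) $
   query 93 (use L165 0124567389) $
   query 83 (use L165 0124567398) $
   cops (walk 034 4 ∷ walk 035 5 ∷ walk 036 6 ∷ walk 037 7 ∷ walk 038 98 ∷ []) 03)

star₂ : Lemma
star₂ = lemma 1020 0
  (query 90 (use star₃ 0129456783) $
   query 80 (use star₃ 0128456739) $
   query 70 (use star₃ 0127456389) $
   query 60 (use star₃ 0126453789) $
   query 50 (use star₃ 0125436789) $
   query 40 (use star₃ 0124356789) $
   query 30 (use star₃ 0123456789) $
   query 98 (use L166 0123456789) $
   query 97 (use L166 0123456879) $
   query 87 (use L166 0123456978) $
   query 96 (use L166 0123457869) $
   query 86 (use L166 0123457968) $
   query 76 (use L166 0123458967) $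
   query 95 (use L166 0123467859) $
   query 85 (use L166 0123467958) $
   query 75 (use L166 0123468957) $
   query 65 (use L166 0123478956) $
   query 94 (use L166 0123567849) $
   query 93 (use L166 0124567839) $
   query 84 (use L166 0123567948) $
   query 83 (use L166 0124567938) $
   query 74 (use L166 0123568947) $
   query 73 (use L166 0124568937) $
   query 64 (use L166 0123578946) $
   query 63 (use L166 0124578936) $
   query 54 (use L166 0123678945) $
   query 53 (use L166 0124678935) $
   query 43 (use L166 0125678934) $
   cops (walk 034 4 ∷ walk 035 5 ∷ walk 036 6 ∷ walk 037 7 ∷ walk 038 8 ∷ walk 039 9 ∷ []) 03)

-- No vertex of degree two

-- A further neighbour of 0 or 1 gives a vertex of degree two; without one, {0, 1} is a component by
-- itself.
star₁ : Lemma
star₁ = lemma 10 0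
  (query 91 (use star₂ 1093456782) $
   query 81 (use star₂ 1083456729) $
   query 71 (use star₂ 1073456289) $
   query 61 (use star₂ 1063452789) $
   query 51 (use star₂ 1053426789) $
   query 41 (use star₂ 1043256789) $
   query 30 (use star₂ 0132456789) $
   query 20 (use star₂ 0123456789) $
   query 31 (use star₂ 1032456789) $
   query 90 (use star₂ 0193456782) $
   query 80 (use star₂ 0183456729) $
   query 70 (use star₂ 0173456289) $
   query 60 (use star₂ 0163452789) $
   query 50 (use star₂ 0153426789) $
   query 21 (use star₂ 1023456789) $
   query 40 (use star₂ 0143256789) $
   cut 10 02)

-- K₁,₀ is a single vertex, so nothing is assumed: either 9 has a neighbour or the other nine
-- vertices form a closed set.
star₀ : Lemma
star₀ = lemma 0 0
  (query 98 (use star₁ 8923456701) $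
   query 97 (use star₁ 7923456081) $
   query 96 (use star₁ 6923450781) $
   query 95 (use star₁ 5923406781) $
   query 94 (use star₁ 4923056781) $
   query 93 (use star₁ 3920456781) $
   query 92 (use star₁ 2903456781) $
   query 91 (use star₁ 1923456780) $
   query 90 (use star₁ 0923456781) $
   cut 876543210 09)

classification : ∀ {G} → Connected G → Good G
-- Assigning no pairs leaves `blank`, so every graph extends the shape of `star₀`.
classification {G} conn = valid star₀ conn id (Extends-blank G id)

theorem2 : Connected Petersen × CopNumberIs Petersen 3
    × (∀ (G : Graph 10) → Connected G → CopNumberIs G 3 → G ≅ Petersen)
    × (∀ (G : Graph 10) → Connected G → ¬ (G ≅ Petersen) → CopNumber≤ G 2)
theorem2 =
    Petersen-connected
  , (Petersen-CopsWin-3 , Petersen-¬CopsWin)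
  , (λ G conn (_ , ¬win) → [ (λ win → contradiction win (¬win 2 ≤-refl)) , (λ iso → iso) ]′
                             (classification conn))
  , (λ G conn ¬iso → [ (λ win → 2 , ≤-refl , win) , ⊥-elim ∘ ¬iso ]′ (classification conn))
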